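{- Let $k\geq 1$ and $\ell\geq s\geq r\geq 3$ be integers. Then as $n\to\infty$, $$\mathrm{ex}_r(n,K_s^{(r)},kK_{\ell+1}^r)=(1+o(1))\,\mathcal{N}\big(K_s^{(r)},S_{n,k-1}^r(n-k+1,\ell)\big).$$
   Context: An $r$-graph is a hypergraph all of whose hyperedges have exactly $r$ vertices. $K_s^{(r)}$ is the complete $r$-graph on $s$ vertices. For a graph $F$, the $r$-expansion $F^r$ is obtained from $F$ by adding $r-2$ new vertices to each edge, all new vertices distinct from each other and from $V(F)$; $K_{\ell+1}^r$ is the $r$-expansion of $K_{\ell+1}$, and $kK_{\ell+1}^r$ is the vertex-disjoint union of $k$ copies of it. $\mathcal{T}_r(m,\ell)$ is the complete balanced $\ell$-partite $r$-graph on $m$ vertices (parts of sizes differing by at most one, hyperedges all $r$-sets meeting each part in at most one vertex). $S_{n,t}^r(n-t,\ell)$ is the $n$-vertex $r$-graph obtained by taking a set $U$ of $t$ vertices and a vertex-disjoint copy of $\mathcal{T}_r(n-t,\ell)$, and adding as hyperedges all $r$-sets containing at least one vertex of $U$. $\mathcal{N}(\mathcal{G}_1,\mathcal{G}_2)$ is the number of copies of $\mathcal{G}_1$ in $\mathcal{G}_2$. $\mathrm{ex}_r(n,\mathcal{H},\mathcal{F})$ is the maximum number of copies of $\mathcal{H}$ in an $n$-vertex $r$-graph containing no copy of $\mathcal{F}$. -}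

module Defs where

open import Data.Bool using (Bool; true; false; not; _∧_; _∨_; if_then_else_; T)
open import Data.Nat using (ℕ; zero; suc; _∸_; _≡ᵇ_; _<ᵇ_; NonZero)
open import Data.Nat.DivMod using (_%_)
open import Data.Fin using (Fin; toℕ; _<_)
open import Data.Fin.Subset using (Subset; ⁅_⁆; _∪_; ⋃; ∣_∣)
open import Data.Vec using (Vec; []; _∷_)
open import Data.List as List using (List; [_]; _++_; map; allFin)
open import Data.Bool.ListAction using (all; any)
open import Data.Nat.ListAction using (sum)
open import Data.Product using (_×_)
open import Relation.Binary.PropositionalEquality using (_≡_; _≢_)

allSubsets : (n : ℕ) → List (Subset n)
allSubsets zero = [ [] ]
allSubsets (suc n) = map (true ∷_) (allSubsets n) ++ map (false ∷_) (allSubsets n)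

_⊆ᵇ_ : ∀ {n} → Subset n → Subset n → Bool
[] ⊆ᵇ [] = true
(x ∷ xs) ⊆ᵇ (y ∷ ys) = (not x ∨ y) ∧ (xs ⊆ᵇ ys)

_∈ᵇ_ : ∀ {n} → Fin n → Subset n → Bool
Fin.zero ∈ᵇ (b ∷ _) = b
Fin.suc i ∈ᵇ (_ ∷ bs) = i ∈ᵇ bs

record RGraph (r n : ℕ) : Set where
  field
    edge    : Subset n → Bool
    uniform : ∀ e → T (edge e) → ∣ e ∣ ≡ r
open RGraph public

isCopyKᵇ : ∀ {n} (s r : ℕ) → (Subset n → Bool) → Subset n → Bool
isCopyKᵇ {n} s r E S =
  (∣ S ∣ ≡ᵇ s) ∧ all (λ e → not ((∣ e ∣ ≡ᵇ r) ∧ (e ⊆ᵇ S)) ∨ E e) (allSubsets n)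

copiesK : ∀ {n} (s r : ℕ) → (Subset n → Bool) → ℕ
copiesK {n} s r E = sum (map (λ S → if isCopyKᵇ s r E S then 1 else 0) (allSubsets n))

-- G contains a copy of k K_{ℓ+1}^r : an injective vertex map of k K_{ℓ+1}^r into G
-- mapping hyperedges to hyperedges.
-- Vertices of k K_{ℓ+1}^r: core vertices (i , a), i < k, a ≤ ℓ, and for every copy i
-- and every pair a < b of core indices, r-2 expansion vertices (i , a , b , j), j < r-2.
record ContainsKK {n} (k ℓ r : ℕ) (E : Subset n → Bool) : Set where
  field
    core   : Fin k → Fin (suc ℓ) → Fin n
    extra  : (i : Fin k) (a b : Fin (suc ℓ)) → a < b → Fin (r ∸ 2) → Fin n
    core-inj : ∀ i a i′ a′ → core i a ≡ core i′ a′ → (i ≡ i′) × (a ≡ a′)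
    extra-inj : ∀ i a b p j i′ a′ b′ p′ j′ →
      extra i a b p j ≡ extra i′ a′ b′ p′ j′ →
      (i ≡ i′) × (a ≡ a′) × (b ≡ b′) × (j ≡ j′)
    core-extra-disj : ∀ i a i′ a′ b′ p′ j′ → core i a ≢ extra i′ a′ b′ p′ j′
    edges : ∀ i a b (p : a < b) →
      T (E (⁅ core i a ⁆ ∪ (⁅ core i b ⁆ ∪ ⋃ (List.tabulate (λ j → ⁅ extra i a b p j ⁆)))))

-- S^r_{n,t}(n-t,ℓ) on vertex set Fin n: U = {x | x < t}; the vertices x ≥ t form
-- T_r(n-t,ℓ) with x in part (x - t) mod ℓ (a balanced ℓ-partition).
-- Hyperedges: r-sets meeting U, or r-sets with at most one vertex in each part.
module _ {n : ℕ} (t ℓ : ℕ) .{{_ : NonZero ℓ}} where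
  partOf : Fin n → ℕ
  partOf x = (toℕ x ∸ t) % ℓ

  Sedge : (r : ℕ) → Subset n → Bool
  Sedge r e = (∣ e ∣ ≡ᵇ r) ∧
    (any (λ x → (x ∈ᵇ e) ∧ (toℕ x <ᵇ t)) (allFin n)
     ∨ all (λ x → all (λ y →
          not ((x ∈ᵇ e) ∧ (y ∈ᵇ e) ∧ (toℕ x <ᵇ toℕ y)) ∨ not (partOf x ≡ᵇ partOf y))
        (allFin n)) (allFin n))

{-# OPTIONS --safe #-}

-- Call a pair of vertices light if some set of at most B vertices (B a constant) meets, outside the
-- pair, every edge through it, and heavy otherwise.  Edges through heavy pairs can be chosen greedily
-- and disjointly, so the graph of heavy pairs has no k disjoint (ℓ+1)-cliques, and deleting at most
-- k(ℓ+1) vertices makes it K_{ℓ+1}-free.  Only O(n^{s-1}) copies of K_s^(r) contain a light pair (such a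
-- copy meets the blocking set in a third vertex) or a deleted vertex; the others are s-cliques of a
-- K_{ℓ+1}-free graph.  By Zykov's theorem there are at most C(ℓ,s)(n/ℓ)^s of those, which is also,
-- asymptotically, the number of rainbow s-sets in the extremal construction.

module Submission where

open import Defs
open import Data.Bool using (Bool; true; false; not; _∧_; _∨_; if_then_else_; T)
open import Data.Bool.Properties using (T-∧; T-∨; T?)
open import Data.Empty using (⊥; ⊥-elim)
open import Data.Fin as F using (Fin; zero; suc; toℕ; fromℕ<; combine; remQuot)
import Data.Fin.Properties as Fin
open import Data.Fin.Subset renaming (⊥ to ∅)
open import Data.Fin.Subset.Properties
open import Data.List as List using (List; map; allFin)
open import Data.List.Membership.Propositional using () renaming (_∈_ to _∈ˡ_)
open import Data.List.Membership.Propositional.Properties using (∈-allFin; ∈-map⁺; ∈-++⁺ˡ; ∈-++⁺ʳ)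
open import Data.List.Properties using (map-++; map-∘)
open import Data.List.Relation.Unary.All as All using (All)
open import Data.List.Relation.Unary.All.Properties using (all⁺; all⁻)
open import Data.List.Relation.Unary.AllPairs using (AllPairs)
import Data.List.Relation.Unary.Any as Any
open import Data.List.Relation.Unary.Any.Properties using (any⁻)
open import Data.List.Relation.Unary.Unique.Propositional using (Unique)
open import Data.Nat using (ℕ; zero; suc; _+_; _*_; _∸_; _^_; _≤_; _<_; _≡ᵇ_; _<ᵇ_; z≤n; s≤s; _≟_; _≤?_; _<?_; NonZero)
open import Data.Nat.Combinatorics using (_C_; nCk+nC[k+1]≡[n+1]C[k+1])
open import Data.Nat.DivMod using (_/_; _%_; m%n<n; m<n⇒m%n≡m; [m+kn]%n≡m%n; m≡m%n+[m/n]*n; /-monoˡ-≤; m*n/n≡m)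
open import Data.Nat.ListAction using (sum)
open import Data.Nat.ListAction.Properties using (sum-++)
open import Data.Nat.Properties
open import Data.Nat.Tactic.RingSolver using (solve-∀)
open import Data.Product using (_×_; _,_; proj₁; proj₂; ∃; ∃-syntax; uncurry; map₂)
open import Data.Sum using (_⊎_; inj₁; inj₂)
open import Data.Unit using (tt) renaming (⊤ to Unit)
open import Data.Vec using ([]; _∷_; here; there; lookup; _[_]≔_; tabulate)
open import Data.Vec.Properties using ([]=⇒lookup; lookup⇒[]=; lookup∘tabulate; lookup∘update; []≔-updates; []≔-minimal)
open import Function using (_∘_; Equivalence)
open import Level using (0ℓ)
open import Relation.Binary using (tri<; tri≈; tri>)
open import Relation.Binary.PropositionalEquality
open import Relation.Nullary using (¬_; Dec; does; yes; no; contradiction; ¬?; _×-dec_; _⊎-dec_; _→-dec_; decidable-stable)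
open import Relation.Nullary.Decidable using (dec-true)
open import Relation.Unary using (Pred; Decidable)
open import Algebra.Properties.CommutativeSemigroup +-commutativeSemigroup using () renaming (interchange to +-interchange)

-- A clique in the shadow of an r-graph need not expand, because the hyperedges through its
-- different pairs may be forced to share vertices; heaviness is exactly what a greedy embedding
-- asks for. Accordingly `B` bounds the number of vertices that the embedding ever has to avoid:
-- k(ℓ+1) core vertices, and r-2 expansion vertices for each of k(ℓ+1)^2 index pairs. It does not
-- depend on n, so prescribing a blocking vertex costs a constant where a free vertex would cost n.
-- Only leading terms are compared. Copies that use the k-1 vertices of U number O(n^{s-1}), so
-- rainbow sets alone give a sufficient lower count for the construction. The construction is itself
-- an admissible graph, so the lower half of the theorem needs no estimate. Everything stays in the
-- natural numbers: 1+o(1) becomes `m * X ≤ (m + 1) * Y` for every m and all large n, fractions are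
-- cross-multiplied, and subtractions are avoided by adding a term to both sides.

private variable
  m n q : ℕ

-- Deleting and inserting elements of finite sets

infixl 8 _∖_
_∖_ : Subset n → Fin n → Subset n
S ∖ u = S [ u ]≔ outside

∉-∖ : (S : Subset n) (u : Fin n) → u ∉ S ∖ u
∉-∖ S u u∈ with () ← trans (sym (lookup∘update u S outside)) ([]=⇒lookup u∈)

∈-∖ : ∀ (S : Subset n) {u x} → x ∈ S → x ≢ u → x ∈ S ∖ u
∈-∖ S x∈ x≢u = []≔-minimal S _ _ x≢u x∈

∖-⊆ : (S : Subset n) (u : Fin n) → S ∖ u ⊆ S
∖-⊆ (_ ∷ S) zero    (there x∈) = there x∈
∖-⊆ (_ ∷ S) (suc u) here       = here
∖-⊆ (_ ∷ S) (suc u) (there x∈) = there (∖-⊆ S u x∈)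

∖-≢ : ∀ (S : Subset n) {u x} → x ∈ S ∖ u → x ≢ u
∖-≢ S x∈ refl = ∉-∖ S _ x∈

∣∖∣ : (S : Subset n) (u : Fin n) → u ∈ S → suc ∣ S ∖ u ∣ ≡ ∣ S ∣
∣∖∣ (true  ∷ S) zero    u∈ = refl
∣∖∣ (true  ∷ S) (suc u) (there u∈) = cong suc (∣∖∣ S u u∈)
∣∖∣ (false ∷ S) (suc u) (there u∈) = ∣∖∣ S u u∈

∣insert∣ : (S : Subset n) (u : Fin n) → u ∉ S → ∣ S [ u ]≔ inside ∣ ≡ suc ∣ S ∣
∣insert∣ (true  ∷ S) zero    u∉ = contradiction here u∉
∣insert∣ (false ∷ S) zero    u∉ = refl
∣insert∣ (true  ∷ S) (suc u) u∉ = cong suc (∣insert∣ S u (u∉ ∘ there))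
∣insert∣ (false ∷ S) (suc u) u∉ = ∣insert∣ S u (u∉ ∘ there)

insert-∈⁻ : ∀ (S : Subset n) (u : Fin n) {x} → x ∈ S [ u ]≔ inside → x ≡ u ⊎ x ∈ S
insert-∈⁻ (_ ∷ S) zero    here       = inj₁ refl
insert-∈⁻ (_ ∷ S) zero    (there x∈) = inj₂ (there x∈)
insert-∈⁻ (_ ∷ S) (suc u) here       = inj₂ here
insert-∈⁻ (_ ∷ S) (suc u) (there x∈) with insert-∈⁻ S u x∈
... | inj₁ eq  = inj₁ (cong suc eq)
... | inj₂ x∈′ = inj₂ (there x∈′)

∣q∩p∣+∣p─q∣≡∣p∣ : (p q : Subset n) → ∣ q ∩ p ∣ + ∣ p ─ q ∣ ≡ ∣ p ∣
∣q∩p∣+∣p─q∣≡∣p∣ [] [] = refl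
∣q∩p∣+∣p─q∣≡∣p∣ (true  ∷ p) (true  ∷ q) = cong suc (∣q∩p∣+∣p─q∣≡∣p∣ p q)
∣q∩p∣+∣p─q∣≡∣p∣ (true  ∷ p) (false ∷ q) = trans (+-suc _ _) (cong suc (∣q∩p∣+∣p─q∣≡∣p∣ p q))
∣q∩p∣+∣p─q∣≡∣p∣ (false ∷ p) (true  ∷ q) = ∣q∩p∣+∣p─q∣≡∣p∣ p q
∣q∩p∣+∣p─q∣≡∣p∣ (false ∷ p) (false ∷ q) = ∣q∩p∣+∣p─q∣≡∣p∣ p q

⊈⇒∃ : ∀ {p q : Subset n} → p ⊈ q → ∃ λ x → x ∈ p × x ∉ q
⊈⇒∃ {p = p} {q} p⊈q with Fin.any? (λ x → x ∈? p ×-dec ¬? (x ∈? q))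
... | yes w = w
... | no ¬w = contradiction (λ {x} x∈p → decidable-stable (x ∈? q) (λ x∉q → ¬w (x , x∈p , x∉q))) p⊈q

∣S∣≡suc⇒∃ : ∀ {s} (S : Subset n) → ∣ S ∣ ≡ suc s → Nonempty S
∣S∣≡suc⇒∃ (true ∷ S) _ = zero , here
∣S∣≡suc⇒∃ (false ∷ S) eq with x , x∈ ← ∣S∣≡suc⇒∃ S eq = suc x , there x∈

-- Counting families of subsets

weight : {P : Pred (Subset n) 0ℓ} → Decidable P → Subset n → ℕ
weight P? S = if does (P? S) then 1 else 0

# : {P : Pred (Subset n) 0ℓ} → Decidable P → ℕ
# {n} P? = sum (map (weight P?) (allSubsets n))

#-suc : {P : Pred (Subset (suc n)) 0ℓ} (P? : Decidable P) →
        # P? ≡ # (P? ∘ (true ∷_)) + # (P? ∘ (false ∷_))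
#-suc {n} P? = begin
  sum (map w (map (true ∷_) xs List.++ map (false ∷_) xs))
    ≡⟨ cong sum (map-++ w (map (true ∷_) xs) _) ⟩
  sum (map w (map (true ∷_) xs) List.++ map w (map (false ∷_) xs))
    ≡⟨ sum-++ (map w (map (true ∷_) xs)) _ ⟩
  sum (map w (map (true ∷_) xs)) + sum (map w (map (false ∷_) xs))
    ≡⟨ sym (cong₂ (λ a b → sum a + sum b) (map-∘ xs) (map-∘ xs)) ⟩
  # (P? ∘ (true ∷_)) + # (P? ∘ (false ∷_)) ∎
  where
  open ≡-Reasoning
  w = weight P?
  xs = allSubsets n

weight-∪ : {P Q R : Pred (Subset n) 0ℓ} (P? : Decidable P) (Q? : Decidable Q) (R? : Decidable R) →
  ∀ S → (P S → Q S ⊎ R S) → weight P? S ≤ weight Q? S + weight R? S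
weight-∪ P? Q? R? S sub with P? S | Q? S | R? S
... | no _  | _     | _     = z≤n
... | yes _ | yes _ | _     = s≤s z≤n
... | yes _ | no _  | yes _ = s≤s z≤n
... | yes p | no ¬q | no ¬r with sub p
...   | inj₁ q = contradiction q ¬q
...   | inj₂ r = contradiction r ¬r

weight-⊎ : {P Q R : Pred (Subset n) 0ℓ} (P? : Decidable P) (Q? : Decidable Q) (R? : Decidable R) →
  ∀ S → (Q S → P S) → (R S → P S) → (Q S → R S → ⊥) → weight Q? S + weight R? S ≤ weight P? S
weight-⊎ P? Q? R? S q⇒p r⇒p dis with P? S | Q? S | R? S
... | _     | no _  | no _  = z≤n
... | yes _ | yes _ | no _  = ≤-refl
... | yes _ | no _  | yes _ = ≤-refl
... | _     | yes q | yes r = ⊥-elim (dis q r)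
... | no ¬p | yes q | no _  = contradiction (q⇒p q) ¬p
... | no ¬p | no _  | yes r = contradiction (r⇒p r) ¬p

sum-map-+ : ∀ {A : Set} (f g : A → ℕ) xs → sum (map (λ x → f x + g x) xs) ≡ sum (map f xs) + sum (map g xs)
sum-map-+ f g List.[] = refl
sum-map-+ f g (x List.∷ xs) rewrite sum-map-+ f g xs = +-interchange (f x) (g x) _ _

sum-map-mono : ∀ {A : Set} {f g : A → ℕ} → (∀ x → f x ≤ g x) → ∀ xs → sum (map f xs) ≤ sum (map g xs)
sum-map-mono f≤g List.[] = z≤n
sum-map-mono f≤g (x List.∷ xs) = +-mono-≤ (f≤g x) (sum-map-mono f≤g xs)

module _ {P Q R : Pred (Subset n) 0ℓ} (P? : Decidable P) (Q? : Decidable Q) (R? : Decidable R) where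

  #-∪ : (∀ S → P S → Q S ⊎ R S) → # P? ≤ # Q? + # R?
  #-∪ sub = ≤-trans (sum-map-mono (λ S → weight-∪ P? Q? R? S (sub S)) (allSubsets n))
                    (≤-reflexive (sum-map-+ (weight Q?) (weight R?) (allSubsets n)))

  #-⊎ : (∀ S → Q S → P S) → (∀ S → R S → P S) → (∀ S → Q S → R S → ⊥) → # Q? + # R? ≤ # P?
  #-⊎ q⇒p r⇒p dis = ≤-trans (≤-reflexive (sym (sum-map-+ (weight Q?) (weight R?) (allSubsets n))))
    (sum-map-mono (λ S → weight-⊎ P? Q? R? S (q⇒p S) (r⇒p S) (dis S)) (allSubsets n))

#-none : {P : Pred (Subset n) 0ℓ} (P? : Decidable P) → (∀ S → ¬ P S) → # P? ≡ 0
#-none {n} P? ¬P = go (allSubsets n)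
  where
  go : ∀ xs → sum (map (weight P?) xs) ≡ 0
  go List.[] = refl
  go (S List.∷ xs) with P? S
  ... | yes p = contradiction p (¬P S)
  ... | no _  = go xs

#-mono : {P Q : Pred (Subset n) 0ℓ} (P? : Decidable P) (Q? : Decidable Q) → (∀ S → P S → Q S) → # P? ≤ # Q?
#-mono {n} P? Q? sub = sum-map-mono le (allSubsets n)
  where
  le : ∀ S → weight P? S ≤ weight Q? S
  le S with P? S | Q? S
  ... | no _  | _     = z≤n
  ... | yes _ | yes _ = ≤-refl
  ... | yes p | no ¬q = contradiction (sub S p) ¬q

#-inhabited : {P : Pred (Subset n) 0ℓ} (P? : Decidable P) → ∃ P → 1 ≤ # P?
#-inhabited {zero} P? ([] , p) with P? []
... | yes _ = ≤-refl
... | no ¬p = contradiction p ¬p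
#-inhabited {suc n} P? (true ∷ S , p) = ≤-trans (#-inhabited (P? ∘ (true ∷_)) (S , p))
  (≤-trans (m≤m+n _ _) (≤-reflexive (sym (#-suc P?))))
#-inhabited {suc n} P? (false ∷ S , p) = ≤-trans (#-inhabited (P? ∘ (false ∷_)) (S , p))
  (≤-trans (m≤n+m _ _) (≤-reflexive (sym (#-suc P?))))

#-size0 : ∀ {P : Pred (Subset n) 0ℓ} (P? : Decidable P) → (∀ S → P S → ∣ S ∣ ≡ 0) → # P? ≤ 1
#-size0 {zero} P? size with P? []
... | yes _ = ≤-refl
... | no _  = z≤n
#-size0 {suc n} P? size = begin
  # P?                                      ≡⟨ #-suc P? ⟩
  # (P? ∘ (true ∷_)) + # (P? ∘ (false ∷_))  ≡⟨ cong (_+ # (P? ∘ (false ∷_))) (#-none (P? ∘ (true ∷_)) (λ S p → 1+n≢0 (size (true ∷ S) p))) ⟩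
  # (P? ∘ (false ∷_))                       ≤⟨ #-size0 (P? ∘ (false ∷_)) (λ S → size (false ∷ S)) ⟩
  1                                         ∎
  where open ≤-Reasoning

-- All sets satisfying `P` agree at `u`, so overwriting that coordinate is injective on them. With
-- `false` this injection deletes a vertex, with `true` it inserts one.
#-update : ∀ (u : Fin n) b {P Q : Pred (Subset n) 0ℓ} (P? : Decidable P) (Q? : Decidable Q) →
  (∀ S → P S → lookup S u ≡ not b × Q (S [ u ]≔ b)) → # P? ≤ # Q?
#-update {suc n} zero true P? Q? sub = begin
  # P?                                      ≡⟨ #-suc P? ⟩
  # (P? ∘ (true ∷_)) + # (P? ∘ (false ∷_))  ≡⟨ cong (_+ # (P? ∘ (false ∷_))) (#-none (P? ∘ (true ∷_)) (λ S p → contradiction (proj₁ (sub _ p)) λ ())) ⟩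
  # (P? ∘ (false ∷_))                       ≤⟨ #-mono (P? ∘ (false ∷_)) (Q? ∘ (true ∷_)) (λ S p → proj₂ (sub _ p)) ⟩
  # (Q? ∘ (true ∷_))                        ≤⟨ m≤m+n _ _ ⟩
  # (Q? ∘ (true ∷_)) + # (Q? ∘ (false ∷_))  ≡⟨ sym (#-suc Q?) ⟩
  # Q?                                      ∎
  where open ≤-Reasoning
#-update {suc n} zero false P? Q? sub = begin
  # P?                                      ≡⟨ #-suc P? ⟩
  # (P? ∘ (true ∷_)) + # (P? ∘ (false ∷_))  ≡⟨ cong (# (P? ∘ (true ∷_)) +_) (#-none (P? ∘ (false ∷_)) (λ S p → contradiction (proj₁ (sub _ p)) λ ())) ⟩
  # (P? ∘ (true ∷_)) + 0                    ≡⟨ +-identityʳ _ ⟩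
  # (P? ∘ (true ∷_))                        ≤⟨ #-mono (P? ∘ (true ∷_)) (Q? ∘ (false ∷_)) (λ S p → proj₂ (sub _ p)) ⟩
  # (Q? ∘ (false ∷_))                       ≤⟨ m≤n+m _ _ ⟩
  # (Q? ∘ (true ∷_)) + # (Q? ∘ (false ∷_))  ≡⟨ sym (#-suc Q?) ⟩
  # Q?                                      ∎
  where open ≤-Reasoning
#-update {suc n} (suc u) b P? Q? sub = begin
  # P?                                      ≡⟨ #-suc P? ⟩
  # (P? ∘ (true ∷_)) + # (P? ∘ (false ∷_))
    ≤⟨ +-mono-≤ (#-update u b (P? ∘ (true ∷_)) (Q? ∘ (true ∷_)) (λ S → sub (true ∷ S)))
                (#-update u b (P? ∘ (false ∷_)) (Q? ∘ (false ∷_)) (λ S → sub (false ∷ S))) ⟩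
  # (Q? ∘ (true ∷_)) + # (Q? ∘ (false ∷_))  ≡⟨ sym (#-suc Q?) ⟩
  # Q?                                      ∎
  where open ≤-Reasoning

#-remove : ∀ (u : Fin n) {P Q : Pred (Subset n) 0ℓ} (P? : Decidable P) (Q? : Decidable Q) →
  (∀ S → P S → u ∈ S × Q (S ∖ u)) → # P? ≤ # Q?
#-remove u P? Q? sub = #-update u false P? Q? (λ S p → []=⇒lookup (proj₁ (sub S p)) , proj₂ (sub S p))

#-insert : ∀ (u : Fin n) {P Q : Pred (Subset n) 0ℓ} (P? : Decidable P) (Q? : Decidable Q) →
  (∀ S → P S → u ∉ S × Q (S [ u ]≔ inside)) → # P? ≤ # Q?
#-insert u P? Q? sub = #-update u true P? Q? (λ S p → outside-lookup S (proj₁ (sub S p)) , proj₂ (sub S p))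
  where
  outside-lookup : ∀ S → u ∉ S → lookup S u ≡ false
  outside-lookup S u∉ with lookup S u in eq
  ... | true  = contradiction (lookup⇒[]= u S eq) u∉
  ... | false = refl

-- A union bound. The indices range over a `Subset` so that a blocking set, a set of non-neighbours
-- or the whole vertex set can take the place of `W`.
#-cover : ∀ (W : Subset m) {P : Pred (Subset n) 0ℓ} {Q : Fin m → Pred (Subset n) 0ℓ}
  (P? : Decidable P) (Q? : ∀ u → Decidable (Q u)) →
  (∀ S → P S → ∃ λ u → u ∈ W × Q u S) →
  ∀ c → (∀ u → u ∈ W → # (Q? u) ≤ c) → # P? ≤ ∣ W ∣ * c
#-cover [] P? Q? cov c bd = ≤-reflexive (#-none P? λ S p → contradiction (proj₁ (cov S p)) λ ())
#-cover (true ∷ W) {P} {Q} P? Q? cov c bd = begin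
  # P?               ≤⟨ #-∪ P? (Q? zero) rest? split ⟩
  # (Q? zero) + # rest?
    ≤⟨ +-mono-≤ (bd zero here) (#-cover W rest? (Q? ∘ suc) (λ _ r → r) c (λ u u∈ → bd (suc u) (there u∈))) ⟩
  c + ∣ W ∣ * c ∎
  where
  open ≤-Reasoning
  rest? : Decidable (λ S → ∃ λ u → u ∈ W × Q (suc u) S)
  rest? S = Fin.any? (λ u → u ∈? W ×-dec Q? (suc u) S)
  split : ∀ S → P S → Q zero S ⊎ (∃ λ u → u ∈ W × Q (suc u) S)
  split S p with cov S p
  ... | zero  , _        , q = inj₁ q
  ... | suc u , there u∈ , q = inj₂ (u , u∈ , q)
#-cover (false ∷ W) {P} {Q} P? Q? cov c bd = #-cover W P? (Q? ∘ suc) cov′ c (λ u u∈ → bd (suc u) (there u∈))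
  where
  cov′ : ∀ S → P S → ∃ λ u → u ∈ W × Q (suc u) S
  cov′ S p with cov S p
  ... | suc u , there u∈ , q = u , u∈ , q

#-pack : ∀ q {P : Pred (Subset n) 0ℓ} {Q : Fin q → Pred (Subset n) 0ℓ}
  (P? : Decidable P) (Q? : ∀ j → Decidable (Q j)) →
  (∀ j S → Q j S → P S) → (∀ i j S → Q i S → Q j S → i ≡ j) →
  ∀ c → (∀ j → c ≤ # (Q? j)) → q * c ≤ # P?
#-pack zero P? Q? sub dis c bd = z≤n
#-pack (suc q) {P} {Q} P? Q? sub dis c bd = begin
  c + q * c
    ≤⟨ +-mono-≤ (bd zero) (#-pack q rest? (Q? ∘ suc) (λ j S r → j , r)
         (λ i j S x y → Fin.suc-injective (dis (suc i) (suc j) S x y)) c (bd ∘ suc)) ⟩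
  # (Q? zero) + # rest?
    ≤⟨ #-⊎ P? (Q? zero) rest? (sub zero) (λ { S (j , r) → sub (suc j) S r })
         (λ { S x (j , y) → Fin.0≢1+n (dis zero (suc j) S x y) }) ⟩
  # P? ∎
  where
  open ≤-Reasoning
  rest? : Decidable (λ S → ∃ λ u → Q (suc u) S)
  rest? S = Fin.any? (λ u → Q? (suc u) S)

SubsetOf : ℕ → Subset n → Pred (Subset n) 0ℓ
SubsetOf s W S = ∣ S ∣ ≡ s × S ⊆ W

subsetOf? : ∀ s (W : Subset n) → Decidable (SubsetOf s W)
subsetOf? s W S = ∣ S ∣ ≟ s ×-dec S ⊆? W

-- Picking an element and deleting it, `s` times, gives a power instead of a binomial coefficient.
-- The loss is harmless: the bound serves for error terms and degenerate cases only.
#-subsetOf : ∀ s (W : Subset n) → # (subsetOf? s W) ≤ ∣ W ∣ ^ s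
#-subsetOf zero W = #-size0 (subsetOf? 0 W) (λ S → proj₁)
#-subsetOf (suc s) W = #-cover W (subsetOf? (suc s) W) (λ u S → u ∈? S ×-dec subsetOf? (suc s) W S)
  (λ S p → let x , x∈ = ∣S∣≡suc⇒∃ S (proj₁ p) in x , proj₂ p x∈ , x∈ , p) _
  (λ u u∈ → ≤-trans (#-remove u (λ S → u ∈? S ×-dec subsetOf? (suc s) W S) (subsetOf? s W)
      (λ { S (u∈S , eq , S⊆W) → u∈S , suc-injective (trans (∣∖∣ S u u∈S) eq) , λ x∈ → S⊆W (∖-⊆ S u x∈) }))
    (#-subsetOf s W))

-- Binomial and power inequalities behind the clique bound

-- The absorption identity (s+1)C(p,s+1) = (p-s)C(p,s), rearranged without subtraction.
C-absorb : ∀ p s → suc s * (p C suc s) + s * (p C s) ≡ p * (p C s)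
C-absorb zero    zero    = refl
C-absorb zero    (suc s) = cong₂ _+_ (*-zeroʳ (suc (suc s))) (*-zeroʳ (suc s))
C-absorb (suc p) zero    = begin
  1 * (suc p C 1) + 0                ≡⟨ +-identityʳ _ ⟩
  1 * (suc p C 1)                    ≡⟨ cong (1 *_) (sym (nCk+nC[k+1]≡[n+1]C[k+1] p 0)) ⟩
  1 * (1 + (p C 1))                ≡⟨ *-identityˡ _ ⟩
  1 + (p C 1)                        ≡⟨ cong suc (trans (sym (trans (+-identityʳ _) (*-identityˡ _))) (C-absorb p 0)) ⟩
  1 + p * 1                   ∎
  where open ≡-Reasoning
C-absorb (suc p) (suc s)
  rewrite sym (nCk+nC[k+1]≡[n+1]C[k+1] p s) | sym (nCk+nC[k+1]≡[n+1]C[k+1] p (suc s)) = begin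
  suc (suc s) * (b + c) + suc s * (a + b)
    ≡⟨ lemma₁ s a b c ⟩
  (suc (suc s) * c + suc s * b) + (suc s * b + s * a) + (a + b)
    ≡⟨ cong₂ (λ x y → x + y + (a + b)) (C-absorb p (suc s)) (C-absorb p s) ⟩
  p * b + p * a + (a + b)
    ≡⟨ lemma₂ p a b ⟩
  suc p * (a + b) ∎
  where
  open ≡-Reasoning
  a = p C s
  b = p C suc s
  c = p C suc (suc s)
  lemma₁ : ∀ s a b c → suc (suc s) * (b + c) + suc s * (a + b)
         ≡ (suc (suc s) * c + suc s * b) + (suc s * b + s * a) + (a + b)
  lemma₁ = solve-∀
  lemma₂ : ∀ p a b → p * b + p * a + (a + b) ≡ suc p * (a + b)
  lemma₂ = solve-∀

2xy≤x²+y² : ∀ x y → 2 * (x * y) ≤ x * x + y * y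
2xy≤x²+y² x y with ≤-total x y
... | inj₁ x≤y with d , refl ← m≤n⇒∃[o]m+o≡n x≤y = ≤-trans (m≤m+n _ (d * d)) (≤-reflexive (square x d))
  where
  square : ∀ x d → 2 * (x * (x + d)) + d * d ≡ x * x + (x + d) * (x + d)
  square = solve-∀
... | inj₂ y≤x with d , refl ← m≤n⇒∃[o]m+o≡n y≤x = ≤-trans (m≤m+n _ (d * d)) (≤-reflexive (square y d))
  where
  square : ∀ y d → 2 * ((y + d) * y) + d * d ≡ (y + d) * (y + d) + y * y
  square = solve-∀

-- The curve z^(s+1) lies above its tangent at x; this is that inequality evaluated at w, with the
-- negative term moved across.
bernoulli : ∀ s x w → suc s * (x ^ s * w) ≤ w ^ suc s + s * x ^ suc s
bernoulli zero x w = ≤-reflexive (base w)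
  where
  base : ∀ w → 1 * (1 * w) ≡ w * 1 + 0
  base = solve-∀
-- Adding s·x^(s+1)·w raises the coefficient from s+2 to 2(s+1), so that 2xw ≤ x²+w² applies to the
-- whole left side.
bernoulli (suc s) x w = +-cancelʳ-≤ (s * (x * y * w)) _ _ (begin
  suc (suc s) * (x * y * w) + s * (x * y * w)
    ≡⟨ regroup₁ s x y w ⟩
  suc s * (y * (2 * (x * w)))
    ≤⟨ *-monoʳ-≤ (suc s) (*-monoʳ-≤ y (2xy≤x²+y² x w)) ⟩
  suc s * (y * (x * x + w * w))
    ≡⟨ regroup₂ s x y w ⟩
  w * (suc s * (y * w)) + suc s * (x * (x * y))
    ≤⟨ +-monoˡ-≤ _ (*-monoʳ-≤ w (bernoulli s x w)) ⟩
  w * (w * w ^ s + s * (x * y)) + suc s * (x * (x * y))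
    ≡⟨ regroup₃ s x y w (w ^ s) ⟩
  w * (w * w ^ s) + suc s * (x * (x * y)) + s * (x * y * w) ∎)
  where
  open ≤-Reasoning
  y = x ^ s
  regroup₁ : ∀ s x y w → suc (suc s) * (x * y * w) + s * (x * y * w) ≡ suc s * (y * (2 * (x * w)))
  regroup₁ = solve-∀
  regroup₂ : ∀ s x y w → suc s * (y * (x * x + w * w)) ≡ w * (suc s * (y * w)) + suc s * (x * (x * y))
  regroup₂ = solve-∀
  regroup₃ : ∀ s x y w z → w * (w * z + s * (x * y)) + suc s * (x * (x * y))
    ≡ w * (w * z) + suc s * (x * (x * y)) + s * (x * y * w)
  regroup₃ = solve-∀

^-distribʳ-* : ∀ k m n → (m * n) ^ k ≡ m ^ k * n ^ k
^-distribʳ-* zero    m n = refl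
^-distribʳ-* (suc k) m n = trans (cong (m * n *_) (^-distribʳ-* k m n)) ([m*n]*[o*p]≡[m*o]*[n*p] m n (m ^ k) (n ^ k))

-- Here d and R count neighbours and non-neighbours of the vertex chosen in `clique-step`. Both
-- sides agree when d is the fraction p/ℓ of d+R, as in a balanced complete ℓ-partite graph. Hence
-- `bernoulli` is applied with x = ℓd and w = p(d+R), which coincide in that case.
maclaurin-step : ∀ p s d R → let ℓ = suc p in
  ℓ ^ suc s * ((p C suc s) * d ^ suc s + p * R * ((p C s) * d ^ s))
    ≤ p ^ suc s * ((ℓ C suc s) * (d + R) ^ suc s)
maclaurin-step p s d R rewrite sym (nCk+nC[k+1]≡[n+1]C[k+1] p s) = *-cancelˡ-≤ (suc s) (begin
  suc s * (ℓ ^ suc s * (b * (d * D) + p * R * (a * D)))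
    ≡⟨ lhs s ℓ L b d D p R a ⟩
  ℓ * (L * D) * (suc s * b * d + suc s * (p * R * a))
    ≡⟨ cong (λ z → ℓ * z * (suc s * b * d + suc s * (p * R * a))) (sym (^-distribʳ-* s ℓ d)) ⟩
  ℓ * X^s * (suc s * b * d + suc s * (p * R * a))
    ≤⟨ +-cancelʳ-≤ (ℓ * a * (s * (X * X^s))) _ _ key ⟩
  ℓ * a * (p * N) ^ suc s
    ≡⟨ cong (ℓ * a *_) (^-distribʳ-* (suc s) p N) ⟩
  ℓ * a * (p ^ suc s * N ^ suc s)
    ≡⟨ cong (_* (p ^ suc s * N ^ suc s)) absorb ⟩
  suc s * (a + b) * (p ^ suc s * N ^ suc s)
    ≡⟨ rhs s (a + b) (p ^ suc s) (N ^ suc s) ⟩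
  suc s * (p ^ suc s * ((a + b) * N ^ suc s)) ∎)
  where
  open ≤-Reasoning
  ℓ = suc p
  N = d + R
  a = p C s
  b = p C suc s
  L = ℓ ^ s
  D = d ^ s
  X = ℓ * d
  X^s = X ^ s
  lhs : ∀ s ℓ L b d D p R a → suc s * (ℓ * L * (b * (d * D) + p * R * (a * D)))
      ≡ ℓ * (L * D) * (suc s * b * d + suc s * (p * R * a))
  lhs = solve-∀
  rhs : ∀ s c P Q → suc s * c * (P * Q) ≡ suc s * (P * (c * Q))
  rhs = solve-∀
  absorb : ℓ * a ≡ suc s * (a + b)
  absorb = trans (cong (a +_) (sym (C-absorb p s))) (expand s a b)
    where
    expand : ∀ s a b → a + (suc s * b + s * a) ≡ suc s * (a + b)
    expand = solve-∀
  -- The term s·X^(s+1) of `bernoulli` is carried on both sides. With it, `C-absorb` gives d the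
  -- same coefficient (s+1)pa as R, and the factor p(d+R) comes out.
  key : ℓ * X^s * (suc s * b * d + suc s * (p * R * a)) + ℓ * a * (s * (X * X^s))
      ≤ ℓ * a * (p * N) ^ suc s + ℓ * a * (s * (X * X^s))
  key = begin
    ℓ * X^s * (suc s * b * d + suc s * (p * R * a)) + ℓ * a * (s * (X * X^s))
      ≡⟨ collect s p X^s b d R a ⟩
    ℓ * X^s * ((suc s * b + s * a) * d + suc s * (p * R * a) + s * a * p * d)
      ≡⟨ cong (λ z → ℓ * X^s * (z * d + suc s * (p * R * a) + s * a * p * d)) (C-absorb p s) ⟩
    ℓ * X^s * (p * a * d + suc s * (p * R * a) + s * a * p * d)
      ≡⟨ factor s p X^s d R a ⟩
    ℓ * a * (suc s * (X^s * (p * N)))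
      ≤⟨ *-monoʳ-≤ (ℓ * a) (bernoulli s X (p * N)) ⟩
    ℓ * a * ((p * N) ^ suc s + s * (X * X^s))
      ≡⟨ *-distribˡ-+ (ℓ * a) _ _ ⟩
    ℓ * a * (p * N) ^ suc s + ℓ * a * (s * (X * X^s)) ∎
    where
    collect : ∀ s p Y b d R a →
      suc p * Y * (suc s * b * d + suc s * (p * R * a)) + suc p * a * (s * (suc p * d * Y))
      ≡ suc p * Y * ((suc s * b + s * a) * d + suc s * (p * R * a) + s * a * p * d)
    collect = solve-∀
    factor : ∀ s p Y d R a →
      suc p * Y * (p * a * d + suc s * (p * R * a) + s * a * p * d)
      ≡ suc p * a * (suc s * (Y * (p * (d + R))))
    factor = solve-∀

-- Zykov's clique bound

maximiser : ∀ {n} (f : Fin n → ℕ) (W : Subset n) → Nonempty W → ∃ λ v → v ∈ W × (∀ u → u ∈ W → f u ≤ f v)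
maximiser f (b ∷ W) ne with nonempty? W
maximiser f (false ∷ W) (suc x , there x∈) | no ¬ne = contradiction (x , x∈) ¬ne
maximiser f (true  ∷ W) ne | no ¬ne = zero , here , λ where
  zero    _          → ≤-refl
  (suc u) (there u∈) → contradiction (u , u∈) ¬ne
maximiser f (b ∷ W) ne | yes ne′ with maximiser (f ∘ suc) W ne′
maximiser f (false ∷ W) ne | yes ne′ | v , v∈ , max = suc v , there v∈ , λ where
  (suc u) (there u∈) → max u u∈
maximiser f (true ∷ W) ne | yes ne′ | v , v∈ , max with ≤-total (f zero) (f (suc v))
... | inj₁ le = suc v , there v∈ , λ where
  zero    _          → le
  (suc u) (there u∈) → max u u∈
... | inj₂ ge = zero , here , λ where
  zero    _          → ≤-refl
  (suc u) (there u∈) → ≤-trans (max u u∈) ge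

Empty⇒∣p∣≡0 : ∀ {n} (p : Subset n) → Empty p → ∣ p ∣ ≡ 0
Empty⇒∣p∣≡0 {n} p emp = trans (cong ∣_∣ (Empty-unique emp)) (∣⊥∣≡0 n)

module Cliques {n : ℕ} (Adj : Fin n → Fin n → Set) (Adj? : ∀ x y → Dec (Adj x y)) where

  N : Fin n → Subset n
  N v = tabulate (λ x → does (Adj? v x))

  ∈N⁻ : ∀ {v x} → x ∈ N v → Adj v x
  ∈N⁻ {v} {x} x∈ with Adj? v x | trans (sym (lookup∘tabulate (λ x → does (Adj? v x)) x)) ([]=⇒lookup x∈)
  ... | yes a | _ = a

  ∈N⁺ : ∀ {v x} → Adj v x → x ∈ N v
  ∈N⁺ {v} {x} a = lookup⇒[]= x (N v) (trans (lookup∘tabulate _ x) (dec-true (Adj? v x) a))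

  Clique : ℕ → Subset n → Pred (Subset n) 0ℓ
  Clique s W S = SubsetOf s W S × (∀ x y → x ∈ S → y ∈ S → x ≢ y → Adj x y)

  clique? : ∀ s W → Decidable (Clique s W)
  clique? s W S = subsetOf? s W S ×-dec
    Fin.all? λ x → Fin.all? λ y → x ∈? S →-dec y ∈? S →-dec ¬? (x Fin.≟ y) →-dec Adj? x y

  #cliques : ℕ → Subset n → ℕ
  #cliques s W = # (clique? s W)

  #cliques≤ : ∀ s W → #cliques s W ≤ ∣ W ∣ ^ s
  #cliques≤ s W = ≤-trans (#-mono (clique? s W) (subsetOf? s W) (λ S → proj₁)) (#-subsetOf s W)

  -- Freeness in this form passes to neighbourhoods by definition: a clique of order q in `N v ∩ W`
  -- with `v ∈ W` is one of order q+1 in `W`. This is the descent of `zykov`.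
  HasK : ℕ → Subset n → Set
  HasK zero    W = Unit
  HasK (suc q) W = ∃ λ v → v ∈ W × HasK q (N v ∩ W)

  hasK? : ∀ q W → Dec (HasK q W)
  hasK? zero    W = yes tt
  hasK? (suc q) W = Fin.any? λ v → v ∈? W ×-dec hasK? q (N v ∩ W)

  -- Erdős' degree-majorisation step: every clique not inside N v contains
  -- a vertex outside N v, and no vertex lies in more cliques than v.
  clique-step : ∀ s W → Nonempty W → ∃ λ v → v ∈ W ×
    #cliques (suc s) W ≤ #cliques (suc s) (N v ∩ W) + ∣ W ─ N v ∣ * #cliques s (N v ∩ W)
  clique-step s W ne with v , v∈ , max ← maximiser (λ u → #cliques s (N u ∩ W)) W ne = v , v∈ , (begin
      #cliques (suc s) W
        ≤⟨ #-∪ (clique? (suc s) W) (clique? (suc s) (N v ∩ W)) leaving? split ⟩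
      #cliques (suc s) (N v ∩ W) + # leaving?
        ≤⟨ +-monoʳ-≤ _ (#-cover (W ─ N v) leaving? through? (λ _ r → r) _
             λ u u∈ → ≤-trans (#-remove u (through? u) (clique? s (N u ∩ W)) (drop u)) (max u (p─q⊆p W (N v) u∈))) ⟩
      #cliques (suc s) (N v ∩ W) + ∣ W ─ N v ∣ * #cliques s (N v ∩ W) ∎)
    where
    open ≤-Reasoning
    Through : Fin n → Pred (Subset n) 0ℓ
    Through u S = u ∈ S × Clique (suc s) W S
    through? : ∀ u → Decidable (Through u)
    through? u S = u ∈? S ×-dec clique? (suc s) W S
    leaving? : Decidable (λ S → ∃ λ u → u ∈ W ─ N v × Through u S)
    leaving? S = Fin.any? λ u → u ∈? (W ─ N v) ×-dec through? u S
    split : ∀ S → Clique (suc s) W S → Clique (suc s) (N v ∩ W) S ⊎ (∃ λ u → u ∈ W ─ N v × Through u S)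
    split S cl@((size , S⊆W) , adj) with S ⊆? N v
    ... | yes S⊆N = inj₁ ((size , λ x∈ → x∈p∩q⁺ (S⊆N x∈ , S⊆W x∈)) , adj)
    ... | no S⊈N with x , x∈ , x∉ ← ⊈⇒∃ S⊈N = inj₂ (x , x∈p∧x∉q⇒x∈p─q (S⊆W x∈) x∉ , x∈ , cl)
    drop : ∀ u S → Through u S → u ∈ S × Clique s (N u ∩ W) (S ∖ u)
    drop u S (u∈ , (size , S⊆W) , adj) =
      u∈ , (suc-injective (trans (∣∖∣ S u u∈) size) ,
            λ {x} x∈ → x∈p∩q⁺ (∈N⁺ (adj u x u∈ (∖-⊆ S u x∈) (≢-sym (∖-≢ S x∈))) , S⊆W (∖-⊆ S u x∈))) ,
      λ x y x∈ y∈ → adj x y (∖-⊆ S u x∈) (∖-⊆ S u y∈)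

  -- The neighbourhood supplied by `clique-step` is free of a clique one smaller, so its clique
  -- counts of orders s+1 and s both obey the bound with one class fewer; `maclaurin-step`
  -- recombines them.
  zykov : ∀ p W → ¬ HasK (suc (suc p)) W → ∀ s → suc p ^ s * #cliques s W ≤ (suc p C s) * ∣ W ∣ ^ s
  zykov p W free zero = ≤-trans (≤-reflexive (*-identityˡ _)) (#cliques≤ 0 W)
  zykov p W free (suc s) with nonempty? W
  ... | no emp = ≤-trans (*-monoʳ-≤ (suc p ^ suc s)
          (≤-trans (#cliques≤ (suc s) W) (≤-reflexive (cong (_^ suc s) (Empty⇒∣p∣≡0 W emp)))))
          (≤-trans (≤-reflexive (*-zeroʳ (suc p ^ suc s))) z≤n)
  ... | yes ne with v , v∈ , step ← clique-step s W ne = extend p free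
    where
    open ≤-Reasoning
    K = N v ∩ W
    d = ∣ K ∣
    R = ∣ W ─ N v ∣
    extend : ∀ p → ¬ HasK (suc (suc p)) W → suc p ^ suc s * #cliques (suc s) W ≤ (suc p C suc s) * ∣ W ∣ ^ suc s
    extend zero free = begin
      1 ^ suc s * #cliques (suc s) W          ≡⟨ trans (cong (_* #cliques (suc s) W) (^-zeroˡ (suc s))) (*-identityˡ _) ⟩
      #cliques (suc s) W                      ≤⟨ step ⟩
      #cliques (suc s) K + R * #cliques s K
        ≤⟨ +-mono-≤ (#cliques≤ (suc s) K) (*-monoʳ-≤ R (#cliques≤ s K)) ⟩
      d ^ suc s + R * d ^ s                   ≡⟨ cong (λ z → z ^ suc s + R * z ^ s) d≡0 ⟩
      R * 0 ^ s                               ≤⟨ *-monoˡ-≤ (0 ^ s) (∣p─q∣≤∣p∣ W (N v)) ⟩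
      ∣ W ∣ * 0 ^ s                           ≤⟨ tail s ⟩
      (1 C suc s) * ∣ W ∣ ^ suc s             ∎
      where
      d≡0 : d ≡ 0
      d≡0 = Empty⇒∣p∣≡0 K λ (x , x∈) → free (v , v∈ , x , x∈ , tt)
      -- `0 ^ s` is 1 only for s = 0, where the cliques are single vertices and the right side is
      -- |W|.
      tail : ∀ s → ∣ W ∣ * 0 ^ s ≤ (1 C suc s) * ∣ W ∣ ^ suc s
      tail zero    = ≤-reflexive (sym (*-identityˡ _))
      tail (suc s) = ≤-trans (≤-reflexive (*-zeroʳ ∣ W ∣)) z≤n
    -- The induction hypotheses carry powers of p′ on their left, so the goal is multiplied by
    -- p′^(s+1), to be cancelled at the end.
    extend p′@(suc p) free = *-cancelˡ-≤ (p′ ^ suc s) {{m^n≢0 p′ (suc s)}} (begin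
      p′ ^ suc s * (suc p′ ^ suc s * #cliques (suc s) W)
        ≤⟨ *-monoʳ-≤ (p′ ^ suc s) (*-monoʳ-≤ (suc p′ ^ suc s) step) ⟩
      p′ ^ suc s * (suc p′ ^ suc s * (#cliques (suc s) K + R * #cliques s K))
        ≡⟨ regroup p′ (p′ ^ s) (suc p′ ^ suc s) (#cliques (suc s) K) R (#cliques s K) ⟩
      suc p′ ^ suc s * (p′ ^ suc s * #cliques (suc s) K + p′ * R * (p′ ^ s * #cliques s K))
        ≤⟨ *-monoʳ-≤ (suc p′ ^ suc s)
             (+-mono-≤ (zykov p K freeK (suc s)) (*-monoʳ-≤ (p′ * R) (zykov p K freeK s))) ⟩
      suc p′ ^ suc s * ((p′ C suc s) * d ^ suc s + p′ * R * ((p′ C s) * d ^ s))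
        ≤⟨ maclaurin-step p′ s d R ⟩
      p′ ^ suc s * ((suc p′ C suc s) * (d + R) ^ suc s)
        ≡⟨ cong (λ z → p′ ^ suc s * ((suc p′ C suc s) * z ^ suc s)) (∣q∩p∣+∣p─q∣≡∣p∣ W (N v)) ⟩
      p′ ^ suc s * ((suc p′ C suc s) * ∣ W ∣ ^ suc s) ∎)
      where
      freeK : ¬ HasK (suc (suc p)) K
      freeK h = free (v , v∈ , h)
      regroup : ∀ p P L a R b → p * P * (L * (a + R * b)) ≡ L * (p * P * a + p * R * (P * b))
      regroup = solve-∀

-- Images, enumerations and intermediate sets

-- Spelled as in the `edges` field of `ContainsKK`, so that the expansions found below fit that
-- field definitionally.
image : (Fin q → Fin n) → Subset n
image X = ⋃ (List.tabulate (λ j → ⁅ X j ⁆))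

∈-image⁺ : (X : Fin q → Fin n) (j : Fin q) → X j ∈ image X
∈-image⁺ X zero    = x∈p∪q⁺ (inj₁ (x∈⁅x⁆ (X zero)))
∈-image⁺ X (suc j) = x∈p∪q⁺ (inj₂ (∈-image⁺ (X ∘ suc) j))

∈-image⁻ : (X : Fin q → Fin n) {x : Fin n} → x ∈ image X → ∃ λ j → x ≡ X j
∈-image⁻ {zero}  X x∈ = contradiction x∈ ∉⊥
∈-image⁻ {suc q} X x∈ with x∈p∪q⁻ ⁅ X zero ⁆ _ x∈
... | inj₁ x∈0 = zero , x∈⁅y⁆⇒x≡y _ x∈0
... | inj₂ x∈′ with j , eq ← ∈-image⁻ (X ∘ suc) x∈′ = suc j , eq

∣p∪q∣≤∣p∣+∣q∣ : (p q : Subset n) → ∣ p ∪ q ∣ ≤ ∣ p ∣ + ∣ q ∣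
∣p∪q∣≤∣p∣+∣q∣ [] [] = z≤n
∣p∪q∣≤∣p∣+∣q∣ (true  ∷ p) (true  ∷ q) = s≤s (≤-trans (∣p∪q∣≤∣p∣+∣q∣ p q) (+-monoʳ-≤ ∣ p ∣ (n≤1+n _)))
∣p∪q∣≤∣p∣+∣q∣ (true  ∷ p) (false ∷ q) = s≤s (∣p∪q∣≤∣p∣+∣q∣ p q)
∣p∪q∣≤∣p∣+∣q∣ (false ∷ p) (true  ∷ q) = ≤-trans (s≤s (∣p∪q∣≤∣p∣+∣q∣ p q)) (≤-reflexive (sym (+-suc _ _)))
∣p∪q∣≤∣p∣+∣q∣ (false ∷ p) (false ∷ q) = ∣p∪q∣≤∣p∣+∣q∣ p q

∣image∣≤ : (X : Fin q → Fin n) → ∣ image X ∣ ≤ q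
∣image∣≤ {zero}  {n} X = ≤-reflexive (∣⊥∣≡0 n)
∣image∣≤ {suc q} X = ≤-trans (∣p∪q∣≤∣p∣+∣q∣ ⁅ X zero ⁆ _)
  (+-mono-≤ (≤-reflexive (∣⁅x⁆∣≡1 (X zero))) (∣image∣≤ (X ∘ suc)))

members : (S : Subset n) → ∃ λ (X : Fin ∣ S ∣ → Fin n) → (∀ i j → X i ≡ X j → i ≡ j) ×
     (∀ j → X j ∈ S) × (∀ x → x ∈ S → ∃ λ j → X j ≡ x)
members [] = (λ ()) , (λ ()) , (λ ()) , λ ()
members (true ∷ S) with X , inj , X∈ , surj ← members S =
  (λ { zero → zero ; (suc j) → suc (X j) }) ,
  (λ { zero zero _ → refl ; (suc i) (suc j) eq → cong suc (inj i j (Fin.suc-injective eq)) }) ,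
  (λ { zero → here ; (suc j) → there (X∈ j) }) ,
  (λ { zero _ → zero , refl ; (suc x) (there x∈) → let j , eq = surj x x∈ in suc j , cong suc eq })
members (false ∷ S) with X , inj , X∈ , surj ← members S =
  (λ j → suc (X j)) , (λ i j eq → inj i j (Fin.suc-injective eq)) , (λ j → there (X∈ j)) ,
  λ { (suc x) (there x∈) → let j , eq = surj x x∈ in j , cong suc eq }

enumerate : (S : Subset n) → ∣ S ∣ ≡ q →
  ∃ λ (X : Fin q → Fin n) → (∀ i j → X i ≡ X j → i ≡ j) × image X ≡ S
enumerate {q = q} S refl with X , inj , X∈ , surj ← members S =
  X , inj , ⊆-antisym (λ x∈ → let j , eq = ∈-image⁻ X x∈ in subst (_∈ S) (sym eq) (X∈ j))
                      (λ x∈ → let j , eq = surj _ x∈ in subst (_∈ image X) eq (∈-image⁺ X j))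

⊆-interpolate : ∀ r {p S : Subset n} → p ⊆ S → ∣ p ∣ ≤ r → r ≤ ∣ S ∣ → ∃ λ e → p ⊆ e × e ⊆ S × ∣ e ∣ ≡ r
⊆-interpolate r {[]} {[]} p⊆S lo hi = [] , (λ x → x) , (λ x → x) , sym (n≤0⇒n≡0 hi)
⊆-interpolate r {true ∷ p} {false ∷ S} p⊆S lo hi with () ← p⊆S here
⊆-interpolate r {false ∷ p} {false ∷ S} p⊆S lo hi with e , a , b , c ← ⊆-interpolate r (drop-∷-⊆ p⊆S) lo hi =
  false ∷ e , s⊆s a , s⊆s b , c
⊆-interpolate (suc r) {true ∷ p} {true ∷ S} p⊆S (s≤s lo) (s≤s hi)
  with e , a , b , c ← ⊆-interpolate r (drop-∷-⊆ p⊆S) lo hi = true ∷ e , s⊆s a , s⊆s b , cong suc c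
⊆-interpolate r {false ∷ p} {true ∷ S} p⊆S lo hi with r ≤? ∣ S ∣
... | yes hi′ with e , a , b , c ← ⊆-interpolate r (drop-∷-⊆ p⊆S) lo hi′ = false ∷ e , s⊆s a , out⊆ b , c
-- Here r exceeds the size of the tail `S`, so the whole of `true ∷ S` is the only candidate.
... | no r≰ = true ∷ S , p⊆S , (λ x → x) , ≤-antisym (≰⇒> r≰) hi

-- Boolean definitions as propositions

∈-allSubsets : (S : Subset n) → S ∈ˡ allSubsets n
∈-allSubsets [] = Any.here refl
∈-allSubsets (true  ∷ S) = ∈-++⁺ˡ (∈-map⁺ (true ∷_) (∈-allSubsets S))
∈-allSubsets {suc n} (false ∷ S) = ∈-++⁺ʳ (map (true ∷_) (allSubsets n)) (∈-map⁺ (false ∷_) (∈-allSubsets S))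

T-imp⁻ : ∀ {a b} → T (not a ∨ b) → T a → T b
T-imp⁻ {true} t _ = t

T-imp⁺ : ∀ {a b} → (T a → T b) → T (not a ∨ b)
T-imp⁺ {true}  f = f tt
T-imp⁺ {false} f = tt

⊆ᵇ⁻ : (p q : Subset n) → T (p ⊆ᵇ q) → p ⊆ q
⊆ᵇ⁻ (true ∷ p) (true ∷ q) t here = here
⊆ᵇ⁻ (a ∷ p) (b ∷ q) t (there x∈) = there (⊆ᵇ⁻ p q (proj₂ (Equivalence.to (T-∧ {not a ∨ b}) t)) x∈)

⊆ᵇ⁺ : (p q : Subset n) → p ⊆ q → T (p ⊆ᵇ q)
⊆ᵇ⁺ [] [] sub = tt
⊆ᵇ⁺ (false ∷ p) (b ∷ q) sub = ⊆ᵇ⁺ p q (drop-∷-⊆ sub)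
⊆ᵇ⁺ (true ∷ p) (true ∷ q) sub = ⊆ᵇ⁺ p q (drop-∷-⊆ sub)
⊆ᵇ⁺ (true ∷ p) (false ∷ q) sub with () ← sub here

IsCopyK : ∀ (s r : ℕ) → (Subset n → Bool) → Pred (Subset n) 0ℓ
IsCopyK s r E S = ∣ S ∣ ≡ s × (∀ e → ∣ e ∣ ≡ r → e ⊆ S → T (E e))

isCopyK⁻ : ∀ s r (E : Subset n → Bool) S → T (isCopyKᵇ s r E S) → IsCopyK s r E S
isCopyK⁻ {n} s r E S t with size , full ← Equivalence.to (T-∧ {∣ S ∣ ≡ᵇ s}) t =
  ≡ᵇ⇒≡ _ s size , λ e size-e e⊆S → T-imp⁻ (All.lookup (all⁺ _ (allSubsets n) full) (∈-allSubsets e))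
    (Equivalence.from T-∧ (≡⇒≡ᵇ _ r size-e , ⊆ᵇ⁺ e S e⊆S))

isCopyK⁺ : ∀ s r (E : Subset n → Bool) S → IsCopyK s r E S → T (isCopyKᵇ s r E S)
isCopyK⁺ {n} s r E S (size , full) = Equivalence.from T-∧ (≡⇒≡ᵇ _ s size ,
  all⁻ _ (All.universal (λ e → T-imp⁺ λ t → let a , b = Equivalence.to (T-∧ {∣ e ∣ ≡ᵇ r}) t in
    full e (≡ᵇ⇒≡ _ r a) (⊆ᵇ⁻ e S b)) (allSubsets n)))

-- `does (T? b)` is `b`, so `# (isCopyK? s r E)` unfolds to `copiesK s r E` and the counting lemmas
-- apply to `copiesK` directly.
isCopyK? : ∀ s r (E : Subset n → Bool) → Decidable (λ S → T (isCopyKᵇ s r E S))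
isCopyK? s r E S = T? (isCopyKᵇ s r E S)

Through : ℕ → List (Fin n) → Pred (Subset n) 0ℓ
Through s vs S = ∣ S ∣ ≡ s × All (_∈ S) vs

through? : ∀ s (vs : List (Fin n)) → Decidable (Through s vs)
through? s vs S = ∣ S ∣ ≟ s ×-dec All.all? (_∈? S) vs

-- The prescribed vertices are deleted in turn; distinctness keeps the later ones in the set. The
-- list has one vertex when deletions are counted and three when light pairs are.
#-through : ∀ s (vs : List (Fin n)) → Unique vs → # (through? (List.length vs + s) vs) ≤ n ^ s
#-through {n} s List.[] _ = begin
  # (through? {n} s List.[])    ≤⟨ #-mono (through? {n} s List.[]) (subsetOf? {n} s ⊤) (λ S (size , _) → size , λ _ → ∈⊤) ⟩
  # (subsetOf? {n} s ⊤)         ≤⟨ #-subsetOf {n} s ⊤ ⟩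
  ∣ ⊤ {n} ∣ ^ s                 ≡⟨ cong (_^ s) (∣⊤∣≡n n) ⟩
  n ^ s                         ∎
  where open ≤-Reasoning
#-through s (v List.∷ vs) (v# AllPairs.∷ vs#) = ≤-trans
  (#-remove v (through? _ (v List.∷ vs)) (through? (List.length vs + s) vs)
    λ { S (size , v∈ All.∷ vs∈) → v∈ , suc-injective (trans (∣∖∣ S v v∈) size) ,
      All.zipWith (λ (x∈ , v≢x) → ∈-∖ S x∈ (≢-sym v≢x)) (vs∈ , v#) })
  (#-through s vs vs#)

-- Packing and deleting disjoint cliques

module Packings {n : ℕ} (Adj : Fin n → Fin n → Set) (Adj? : ∀ x y → Dec (Adj x y))
                (irrefl : ∀ x → ¬ Adj x x) where
  open Cliques Adj Adj?

  IsCliqueMap : (Fin q → Fin n) → Set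
  IsCliqueMap c = ∀ a b → a F.< b → Adj (c a) (c b)

  cliqueMap-injective : (c : Fin q → Fin n) → IsCliqueMap c → ∀ a b → c a ≡ c b → a ≡ b
  cliqueMap-injective c adj a b eq with Fin.<-cmp a b
  ... | tri< lt _ _ = contradiction (subst (Adj (c a)) (sym eq) (adj a b lt)) (irrefl _)
  ... | tri≈ _ e _  = e
  ... | tri> _ _ gt = contradiction (subst (Adj (c b)) eq (adj b a gt)) (irrefl _)

  hasK⇒cliqueMap : ∀ q W → HasK q W → ∃ λ (c : Fin q → Fin n) → (∀ a → c a ∈ W) × IsCliqueMap c
  hasK⇒cliqueMap zero W _ = (λ ()) , (λ ()) , λ ()
  hasK⇒cliqueMap (suc q) W (v , v∈ , h) with c , c∈ , adj ← hasK⇒cliqueMap q (N v ∩ W) h =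
    (λ { zero → v ; (suc a) → c a }) ,
    (λ { zero → v∈ ; (suc a) → p∩q⊆q (N v) W (c∈ a) }) ,
    λ { zero (suc b) _ → ∈N⁻ (p∩q⊆p (N v) W (c∈ b)) ; (suc a) (suc b) (s≤s lt) → adj a b lt }

  removeAll : (Fin q → Fin n) → Subset n → Subset n
  removeAll {zero}  c W = W
  removeAll {suc q} c W = removeAll (c ∘ suc) (W ∖ c zero)

  removeAll-⊆ : (c : Fin q → Fin n) (W : Subset n) → removeAll c W ⊆ W
  removeAll-⊆ {zero}  c W x∈ = x∈
  removeAll-⊆ {suc q} c W x∈ = ∖-⊆ W (c zero) (removeAll-⊆ (c ∘ suc) _ x∈)

  removeAll-≢ : (c : Fin q → Fin n) (W : Subset n) {x : Fin n} → x ∈ removeAll c W → ∀ a → x ≢ c a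
  removeAll-≢ c W x∈ zero    = ∖-≢ W (removeAll-⊆ (c ∘ suc) _ x∈)
  removeAll-≢ c W x∈ (suc a) = removeAll-≢ (c ∘ suc) _ x∈ a

  #cliques-∖ : ∀ s W u → #cliques (suc s) W ≤ #cliques (suc s) (W ∖ u) + n ^ s
  #cliques-∖ s W u = ≤-trans
    (#-∪ (clique? (suc s) W) (clique? (suc s) (W ∖ u)) (through? (suc s) List.[ u ]) split)
    (+-monoʳ-≤ _ (#-through s List.[ u ] (All.[] AllPairs.∷ AllPairs.[])))
    where
    split : ∀ S → Clique (suc s) W S → Clique (suc s) (W ∖ u) S ⊎ Through (suc s) List.[ u ] S
    split S ((size , S⊆W) , adj) with u ∈? S
    ... | yes u∈ = inj₂ (size , u∈ All.∷ All.[])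
    ... | no u∉  = inj₁ ((size , λ x∈ → ∈-∖ W (S⊆W x∈) λ { refl → u∉ x∈ }) , adj)

  #cliques-removeAll : ∀ s (c : Fin q → Fin n) W → #cliques (suc s) W ≤ #cliques (suc s) (removeAll c W) + q * n ^ s
  #cliques-removeAll {zero}  s c W = ≤-reflexive (sym (+-identityʳ _))
  #cliques-removeAll {suc q} s c W = begin
    #cliques (suc s) W                                     ≤⟨ #cliques-∖ s W (c zero) ⟩
    #cliques (suc s) (W ∖ c zero) + n ^ s                  ≤⟨ +-monoˡ-≤ (n ^ s) (#cliques-removeAll s (c ∘ suc) _) ⟩
    #cliques (suc s) (removeAll c W) + q * n ^ s + n ^ s   ≡⟨ +-assoc (#cliques (suc s) (removeAll c W)) _ _ ⟩
    #cliques (suc s) (removeAll c W) + (q * n ^ s + n ^ s) ≡⟨ cong (#cliques (suc s) (removeAll c W) +_) (+-comm (q * n ^ s) (n ^ s)) ⟩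
    #cliques (suc s) (removeAll c W) + suc q * n ^ s       ∎
    where open ≤-Reasoning

  record Packing (k q : ℕ) (W : Subset n) : Set where
    field
      core      : Fin k → Fin q → Fin n
      core-∈    : ∀ i a → core i a ∈ W
      core-adj  : ∀ i → IsCliqueMap (core i)
      core-inj  : ∀ i a i′ a′ → core i a ≡ core i′ a′ → (i ≡ i′) × (a ≡ a′)

  packing-extend : ∀ {k q W} (c : Fin q → Fin n) → (∀ a → c a ∈ W) → IsCliqueMap c → Packing k q (removeAll c W) → Packing (suc k) q W
  packing-extend {W = W} c c∈ adj pk = record
    { core     = λ { zero → c ; (suc i) → core i }
    ; core-∈   = λ { zero → c∈ ; (suc i) a → removeAll-⊆ c W (core-∈ i a) }
    ; core-adj = λ { zero → adj ; (suc i) → core-adj i }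
    ; core-inj = λ where
        zero    a zero     a′ eq → refl , cliqueMap-injective c adj a a′ eq
        zero    a (suc i′) a′ eq → contradiction (sym eq) (removeAll-≢ c W (core-∈ i′ a′) a)
        (suc i) a zero     a′ eq → contradiction eq (removeAll-≢ c W (core-∈ i a) a′)
        (suc i) a (suc i′) a′ eq → let e , e′ = core-inj i a i′ a′ eq in cong suc e , e′
    }
    where open Packing pk

  -- Cliques of order q are removed one after another until none is left. This takes fewer than k
  -- rounds, since k removed cliques would form a packing; at `k = 0` the empty packing already
  -- contradicts the hypothesis. Each round destroys only cliques through q given vertices.
  #cliques-unpackable : ∀ s q k W → ¬ Packing k q W →
    ∃ λ W′ → ¬ HasK q W′ × #cliques (suc s) W ≤ #cliques (suc s) W′ + k * (q * n ^ s)
  #cliques-unpackable s q zero W none = contradiction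
    (record { core = λ () ; core-∈ = λ () ; core-adj = λ () ; core-inj = λ () }) none
  #cliques-unpackable s q (suc k) W none with hasK? q W
  ... | no free = W , free , m≤m+n _ _
  ... | yes h with c , c∈ , adj ← hasK⇒cliqueMap q W h
        with W′ , free , le ← #cliques-unpackable s q k (removeAll c W) (none ∘ packing-extend c c∈ adj)
        = W′ , free , (begin
    #cliques (suc s) W                                              ≤⟨ #cliques-removeAll s c W ⟩
    #cliques (suc s) (removeAll c W) + q * n ^ s                    ≤⟨ +-monoˡ-≤ _ le ⟩
    #cliques (suc s) W′ + k * (q * n ^ s) + q * n ^ s               ≡⟨ +-assoc (#cliques (suc s) W′) _ _ ⟩
    #cliques (suc s) W′ + (k * (q * n ^ s) + q * n ^ s)
      ≡⟨ cong (#cliques (suc s) W′ +_) (+-comm (k * (q * n ^ s)) (q * n ^ s)) ⟩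
    #cliques (suc s) W′ + suc k * (q * n ^ s)                       ∎)
    where open ≤-Reasoning

-- Greedy choice of disjoint sets

-- Each chosen image joins the forbidden set, so later choices avoid earlier ones. The last
-- hypothesis is the budget that keeps this set within `B`, where `choose` still answers.
greedy : ∀ B M (Good : Fin M → (Fin q → Fin n) → Set) →
  (∀ i F → ∣ F ∣ ≤ B → ∃ λ X → Good i X × (∀ j → X j ∉ F)) →
  ∀ F → ∣ F ∣ + M * q ≤ B →
  ∃ λ (Y : Fin M → Fin q → Fin n) →
    (∀ i → Good i (Y i)) × (∀ i j → Y i j ∉ F) × (∀ i j i′ j′ → Y i j ≡ Y i′ j′ → i ≡ i′)
greedy B zero Good choose F le = (λ ()) , (λ ()) , (λ ()) , λ ()
greedy {q} B (suc M) Good choose F le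
  with X , good , X∉ ← choose zero F (≤-trans (m≤m+n _ _) le)
  with Y , goods , Y∉ , sep ← greedy B M (Good ∘ suc) (choose ∘ suc) (F ∪ image X)
         (≤-trans (+-monoˡ-≤ (M * q) (≤-trans (∣p∪q∣≤∣p∣+∣q∣ F (image X)) (+-monoʳ-≤ ∣ F ∣ (∣image∣≤ X))))
           (≤-trans (≤-reflexive (+-assoc ∣ F ∣ q (M * q))) le))
  = (λ { zero → X ; (suc i) → Y i }) ,
    (λ { zero → good ; (suc i) → goods i }) ,
    (λ { zero → X∉ ; (suc i) j → Y∉ i j ∘ λ x∈ → x∈p∪q⁺ (inj₁ x∈) }) ,
    λ where
      zero    j zero     j′ eq → refl
      zero    j (suc i′) j′ eq → contradiction (x∈p∪q⁺ (inj₂ (subst (_∈ image X) eq (∈-image⁺ X j)))) (Y∉ i′ j′)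
      (suc i) j zero     j′ eq → contradiction (x∈p∪q⁺ (inj₂ (subst (_∈ image X) (sym eq) (∈-image⁺ X j′)))) (Y∉ i j)
      (suc i) j (suc i′) j′ eq → cong suc (sep i j i′ j′ eq)

-- Light and heavy pairs

module LightPairs {n : ℕ} (E : Subset n → Bool) (B : ℕ) where

  -- `F` may contain `u` and `v` themselves, as it does in `expand`, where it starts as the set of
  -- all core vertices.
  EdgeAvoiding : Fin n → Fin n → Subset n → Pred (Subset n) 0ℓ
  EdgeAvoiding u v F e = T (E e) × u ∈ e × v ∈ e × (∀ w → w ∈ e → w ∈ F → w ≡ u ⊎ w ≡ v)

  edgeAvoiding? : ∀ u v F → Decidable (EdgeAvoiding u v F)
  edgeAvoiding? u v F e = T? (E e) ×-dec u ∈? e ×-dec v ∈? e ×-dec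
    Fin.all? λ w → w ∈? e →-dec w ∈? F →-dec (w Fin.≟ u ⊎-dec w Fin.≟ v)

  Blocks : Fin n → Fin n → Pred (Subset n) 0ℓ
  Blocks u v F = ∣ F ∣ ≤ B × ¬ ∃ (EdgeAvoiding u v F)

  Light : Fin n → Fin n → Set
  Light u v = ∃ (Blocks u v)

  light? : ∀ u v → Dec (Light u v)
  light? u v = anySubset? λ F → ∣ F ∣ ≤? B ×-dec ¬? (anySubset? (edgeAvoiding? u v F))

  Heavy : Fin n → Fin n → Set
  Heavy u v = u ≢ v × ¬ Light u v

  heavy? : ∀ u v → Dec (Heavy u v)
  heavy? u v = ¬? (u Fin.≟ v) ×-dec ¬? (light? u v)

  heavy-irrefl : ∀ u → ¬ Heavy u u
  heavy-irrefl u (u≢u , _) = u≢u refl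

  heavy-edge : ∀ {u v} → Heavy u v → ∀ F → ∣ F ∣ ≤ B → ∃ (EdgeAvoiding u v F)
  heavy-edge {u} {v} (_ , ¬light) F le = decidable-stable (anySubset? (edgeAvoiding? u v F))
    λ none → ¬light (F , le , none)

  IsExpansion : Fin n → Fin n → (Fin q → Fin n) → Set
  IsExpansion u v X = (∀ i j → X i ≡ X j → i ≡ j) × T (E (⁅ u ⁆ ∪ (⁅ v ⁆ ∪ image X)))

  heavy-expansion : ∀ {r} → (∀ e → T (E e) → ∣ e ∣ ≡ r) → ∀ {u v} → Heavy u v → ∀ F → ∣ F ∣ ≤ B →
    ∃ λ (X : Fin (r ∸ 2) → Fin n) → IsExpansion u v X × (∀ j → X j ∉ F)
  heavy-expansion {r} uni {u} {v} hv F le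
    with e , te , u∈ , v∈ , avoid ← heavy-edge hv F le
    with X , inj , im ← enumerate ((e ∖ u) ∖ v) (cong (_∸ 2)
           (trans (cong suc (∣∖∣ (e ∖ u) v (∈-∖ e v∈ (≢-sym (proj₁ hv))))) (trans (∣∖∣ e u u∈) (uni e te))))
    = X , (inj , subst (T ∘ E) (sym whole) te) , X∉
    where
    to : ⁅ u ⁆ ∪ (⁅ v ⁆ ∪ image X) ⊆ e
    to x∈ with x∈p∪q⁻ ⁅ u ⁆ _ x∈
    ... | inj₁ x∈u = subst (_∈ e) (sym (x∈⁅y⁆⇒x≡y u x∈u)) u∈
    ... | inj₂ x∈′ with x∈p∪q⁻ ⁅ v ⁆ _ x∈′
    ...   | inj₁ x∈v = subst (_∈ e) (sym (x∈⁅y⁆⇒x≡y v x∈v)) v∈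
    ...   | inj₂ x∈X = ∖-⊆ e u (∖-⊆ (e ∖ u) v (subst (_ ∈_) im x∈X))
    from : e ⊆ ⁅ u ⁆ ∪ (⁅ v ⁆ ∪ image X)
    from {x} x∈ with x Fin.≟ u | x Fin.≟ v
    ... | yes refl | _        = x∈p∪q⁺ (inj₁ (x∈⁅x⁆ u))
    ... | no _     | yes refl = x∈p∪q⁺ (inj₂ (x∈p∪q⁺ (inj₁ (x∈⁅x⁆ v))))
    ... | no x≢u   | no x≢v   = x∈p∪q⁺ (inj₂ (x∈p∪q⁺ (inj₂ (subst (x ∈_) (sym im) (∈-∖ (e ∖ u) (∈-∖ e x∈ x≢u) x≢v)))))
    whole : ⁅ u ⁆ ∪ (⁅ v ⁆ ∪ image X) ≡ e
    whole = ⊆-antisym to from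
    X∉ : ∀ j → X j ∉ F
    X∉ j Xj∈F with Xj∈ ← subst (X j ∈_) im (∈-image⁺ X j)
              with avoid (X j) (∖-⊆ e u (∖-⊆ (e ∖ u) v Xj∈)) Xj∈F
    ... | inj₁ eq = ∖-≢ e (∖-⊆ (e ∖ u) v Xj∈) eq
    ... | inj₂ eq = ∖-≢ (e ∖ u) Xj∈ eq

  open Cliques Heavy heavy?
  open Packings Heavy heavy? heavy-irrefl

  pair⊆ : ∀ {u v} {S : Subset n} → u ∈ S → v ∈ S → ⁅ u ⁆ ∪ ⁅ v ⁆ ⊆ S
  pair⊆ {u} {v} {S} u∈ v∈ x∈ with x∈p∪q⁻ ⁅ u ⁆ ⁅ v ⁆ x∈
  ... | inj₁ x∈u = subst (_∈ S) (sym (x∈⁅y⁆⇒x≡y u x∈u)) u∈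
  ... | inj₂ x∈v = subst (_∈ S) (sym (x∈⁅y⁆⇒x≡y v x∈v)) v∈

  -- A blocking set of a light pair inside a copy S of K_s^(r) must meet S in a third vertex,
  -- because some r-subset of S contains the pair.
  light-third : ∀ {s r S u v F} → 2 ≤ r → r ≤ s → IsCopyK s r E S → u ∈ S → v ∈ S → Blocks u v F →
    ∃ λ w → w ∈ F × w ∈ S × w ≢ u × w ≢ v
  light-third {r = r} {S} {u} {v} {F} 2≤r r≤s (size , full) u∈ v∈ (_ , none)
    with Fin.any? (λ w → w ∈? F ×-dec w ∈? S ×-dec ¬? (w Fin.≟ u) ×-dec ¬? (w Fin.≟ v))
  ... | yes w = w
  ... | no ¬w with e , pair⊆e , e⊆S , size-e ← ⊆-interpolate r {⁅ u ⁆ ∪ ⁅ v ⁆} {S} (pair⊆ u∈ v∈)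
                     (≤-trans (∣p∪q∣≤∣p∣+∣q∣ ⁅ u ⁆ ⁅ v ⁆) (≤-trans (≤-reflexive (cong₂ _+_ (∣⁅x⁆∣≡1 u) (∣⁅x⁆∣≡1 v))) 2≤r))
                     (≤-trans r≤s (≤-reflexive (sym size)))
    = contradiction (e , full e size-e e⊆S , pair⊆e (x∈p∪q⁺ (inj₁ (x∈⁅x⁆ u))) , pair⊆e (x∈p∪q⁺ (inj₂ (x∈⁅x⁆ v))) , avoid) none
    where
    avoid : ∀ w → w ∈ e → w ∈ F → w ≡ u ⊎ w ≡ v
    avoid w w∈e w∈F with w Fin.≟ u | w Fin.≟ v
    ... | yes eq | _      = inj₁ eq
    ... | no _   | yes eq = inj₂ eq
    ... | no w≢u | no w≢v = contradiction (w , w∈F , e⊆S w∈e , w≢u , w≢v) ¬w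

  module _ (r s : ℕ) (2≤r : 2 ≤ r) (r≤s : r ≤ suc (suc (suc s))) where
    private
      Copy : Pred (Subset n) 0ℓ
      Copy S = T (isCopyKᵇ (3 + s) r E S)

      WithPair : Fin n → Fin n → Pred (Subset n) 0ℓ
      WithPair u v S = u ≢ v × Light u v × u ∈ S × v ∈ S × Copy S

      withPair? : ∀ u v → Decidable (WithPair u v)
      withPair? u v S = ¬? (u Fin.≟ v) ×-dec light? u v ×-dec u ∈? S ×-dec v ∈? S ×-dec isCopyK? (3 + s) r E S

      withVertex? : ∀ u → Decidable (λ S → ∃ λ v → v ∈ ⊤ × WithPair u v S)
      withVertex? u S = Fin.any? λ v → v ∈? ⊤ ×-dec withPair? u v S

      hasLight? : Decidable (λ S → ∃ λ u → u ∈ ⊤ × ∃ λ v → v ∈ ⊤ × WithPair u v S)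
      hasLight? S = Fin.any? λ u → u ∈? ⊤ ×-dec withVertex? u S

      -- A copy is charged to a third vertex w in which it meets the blocking set: at most `B`
      -- choices of w, and three prescribed vertices leave n^s sets of size s+3. A w equal to u or v
      -- is charged nothing.
      #withPair≤ : ∀ u v → # (withPair? u v) ≤ B * n ^ s
      #withPair≤ u v = go (light? u v) (u Fin.≟ v)
        where
        Third : Fin n → Pred (Subset n) 0ℓ
        Third w S = w ≢ u × w ≢ v × Through (3 + s) (u List.∷ v List.∷ w List.∷ List.[]) S
        third? : ∀ w → Decidable (Third w)
        third? w S = ¬? (w Fin.≟ u) ×-dec ¬? (w Fin.≟ v) ×-dec through? (3 + s) (u List.∷ v List.∷ w List.∷ List.[]) S
        bound : u ≢ v → ∀ w → # (third? w) ≤ n ^ s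
        bound u≢v w = cases (w Fin.≟ u) (w Fin.≟ v)
          where
          cases : Dec (w ≡ u) → Dec (w ≡ v) → # (third? w) ≤ n ^ s
          cases (yes w≡u) _ = ≤-trans (≤-reflexive (#-none (third? w) λ S p → proj₁ p w≡u)) z≤n
          cases (no _) (yes w≡v) = ≤-trans (≤-reflexive (#-none (third? w) λ S p → proj₁ (proj₂ p) w≡v)) z≤n
          cases (no w≢u) (no w≢v) = ≤-trans (#-mono (third? w) (through? (3 + s) _) (λ S p → proj₂ (proj₂ p)))
            (#-through s _ ((u≢v All.∷ ≢-sym w≢u All.∷ All.[]) AllPairs.∷ (≢-sym w≢v All.∷ All.[])
              AllPairs.∷ All.[] AllPairs.∷ AllPairs.[]))
        go : Dec (Light u v) → Dec (u ≡ v) → # (withPair? u v) ≤ B * n ^ s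
        go (no heavy) _ = ≤-trans (≤-reflexive (#-none (withPair? u v) λ S p → heavy (proj₁ (proj₂ p)))) z≤n
        go (yes _) (yes u≡v) = ≤-trans (≤-reflexive (#-none (withPair? u v) λ S p → proj₁ p u≡v)) z≤n
        go (yes (F , bl@(F≤B , _))) (no u≢v) = ≤-trans
          (#-cover F (withPair? u v) third? cover (n ^ s) (λ w _ → bound u≢v w)) (*-monoˡ-≤ (n ^ s) F≤B)
          where
          cover : ∀ S → WithPair u v S → ∃ λ w → w ∈ F × Third w S
          cover S (_ , _ , u∈ , v∈ , copy)
            with w , w∈F , w∈S , w≢u , w≢v ← light-third 2≤r r≤s (isCopyK⁻ (3 + s) r E S copy) u∈ v∈ bl =
            w , w∈F , w≢u , w≢v , proj₁ (isCopyK⁻ (3 + s) r E S copy) , u∈ All.∷ v∈ All.∷ w∈S All.∷ All.[]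

    -- The factors n·n choose the light pair. The error thus has order n^(s+2), one power below the
    -- main term.
    copiesK≤#cliques : copiesK (3 + s) r E ≤ #cliques (3 + s) ⊤ + n * (n * (B * n ^ s))
    copiesK≤#cliques = ≤-trans (#-∪ (isCopyK? (3 + s) r E) (clique? (3 + s) ⊤) hasLight? split)
      (+-monoʳ-≤ (#cliques (3 + s) ⊤) (over⊤ hasLight? withVertex? (λ _ p → p)
        λ u → over⊤ (withVertex? u) (withPair? u) (λ _ p → p) (#withPair≤ u)))
      where
      over⊤ : {P : Pred (Subset n) 0ℓ} {Q : Fin n → Pred (Subset n) 0ℓ} (P? : Decidable P) (Q? : ∀ u → Decidable (Q u)) →
        (∀ S → P S → ∃ λ u → u ∈ ⊤ × Q u S) → ∀ {c} → (∀ u → # (Q? u) ≤ c) → # P? ≤ n * c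
      over⊤ P? Q? cov {c} bd = ≤-trans (#-cover ⊤ P? Q? cov c (λ u _ → bd u)) (≤-reflexive (cong (_* c) (∣⊤∣≡n n)))
      split : ∀ S → Copy S → Clique (3 + s) ⊤ S ⊎ (∃ λ u → u ∈ ⊤ × ∃ λ v → v ∈ ⊤ × WithPair u v S)
      split S copy with hasLight? S
      ... | yes hl = inj₂ hl
      ... | no ¬hl = inj₁ ((proj₁ (isCopyK⁻ (3 + s) r E S copy) , λ _ → ∈⊤) ,
        λ x y x∈ y∈ x≢y → x≢y , λ li → ¬hl (x , ∈⊤ , y , ∈⊤ , x≢y , li , x∈ , y∈ , copy))

  -- `extra` is defined for all index pairs, without the proof of `a < b` that `ContainsKK` asks
  -- for, so requests can be numbered by a product of `Fin` types and the chosen vertices do not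
  -- depend on such proofs.
  record Expansions {k L : ℕ} (q : ℕ) (core : Fin k → Fin L → Fin n) : Set where
    field
      extra       : Fin k → Fin L → Fin L → Fin q → Fin n
      extra-inj   : ∀ i a b j i′ a′ b′ j′ → extra i a b j ≡ extra i′ a′ b′ j′ → i ≡ i′ × a ≡ a′ × b ≡ b′ × j ≡ j′
      extra-≢core : ∀ i a i′ a′ b′ j′ → core i a ≢ extra i′ a′ b′ j′
      expansion   : ∀ i a b → a F.< b → IsExpansion (core i a) (core i b) (extra i a b)

  -- There is one request for each triple (i, a, b). Different requests get disjoint answers, so a
  -- common extra vertex forces equal triples; injectivity within a request is part of
  -- `IsExpansion`.
  expand : ∀ {r} → (∀ e → T (E e) → ∣ e ∣ ≡ r) → ∀ {k L} (core : Fin k → Fin L → Fin n) → (∀ i → IsCliqueMap (core i)) →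
    (o o′ : Fin L) → o F.< o′ → k * L + k * (L * L) * (r ∸ 2) ≤ B → Expansions (r ∸ 2) core
  expand {r} uni {k} {L} core core-adj o o′ o<o′ le = assemble (greedy B (k * (L * L)) Good
      (λ x → heavy-expansion uni (endsAt-heavy (unidx x)))
      (image allCore) (≤-trans (+-monoˡ-≤ _ (∣image∣≤ allCore)) le))
    where
    allCore : Fin (k * L) → Fin n
    allCore x = uncurry core (remQuot {k} L x)
    -- The index (a , b) of a pair with a ≥ b carries the dummy request (o , o′).
    ends : ∀ i a b → ∃ λ (uv : Fin n × Fin n) → Heavy (proj₁ uv) (proj₂ uv) ×
      (a F.< b → uv ≡ (core i a , core i b))
    ends i a b with a Fin.<? b
    ... | yes lt = (core i a , core i b) , core-adj i a b lt , λ _ → refl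
    ... | no ≮   = (core i o , core i o′) , core-adj i o o′ o<o′ , λ lt → contradiction lt ≮
    idx : Fin k → Fin L → Fin L → Fin (k * (L * L))
    idx i a b = combine i (combine a b)
    unidx : Fin (k * (L * L)) → Fin k × Fin L × Fin L
    unidx x = map₂ (remQuot {L} L) (remQuot {k} (L * L) x)
    unidx-idx : ∀ i a b → unidx (idx i a b) ≡ (i , a , b)
    unidx-idx i a b = trans (cong (map₂ (remQuot {L} L)) (Fin.remQuot-combine {k} {L * L} i (combine a b)))
                            (cong (i ,_) (Fin.remQuot-combine {L} {L} a b))
    endsAt : Fin k × Fin L × Fin L → Fin n × Fin n
    endsAt (i , a , b) = proj₁ (ends i a b)
    endsAt-heavy : ∀ t → uncurry Heavy (endsAt t)
    endsAt-heavy (i , a , b) = proj₁ (proj₂ (ends i a b))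
    idx-injective : ∀ {i a b i′ a′ b′} → idx i a b ≡ idx i′ a′ b′ → i ≡ i′ × a ≡ a′ × b ≡ b′
    idx-injective {i} {a} {b} {i′} {a′} {b′} eq
      with i≡ , ab≡ ← Fin.combine-injective i (combine a b) i′ (combine a′ b′) eq =
      i≡ , Fin.combine-injective a b a′ b′ ab≡
    core∈ : ∀ i a → core i a ∈ image allCore
    core∈ i a = subst (_∈ image allCore) (cong (uncurry core) (Fin.remQuot-combine i a)) (∈-image⁺ allCore (combine i a))
    Good : Fin (k * (L * L)) → (Fin (r ∸ 2) → Fin n) → Set
    Good x X = uncurry IsExpansion (endsAt (unidx x)) X
    assemble : (∃ λ (Y : Fin (k * (L * L)) → Fin (r ∸ 2) → Fin n) → (∀ x → Good x (Y x)) ×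
      (∀ x j → Y x j ∉ image allCore) × (∀ x j x′ j′ → Y x j ≡ Y x′ j′ → x ≡ x′)) → Expansions (r ∸ 2) core
    assemble (Y , good , avoids , separate) = record
      { extra       = λ i a b → Y (idx i a b)
      ; extra-inj   = λ i a b j i′ a′ b′ j′ eq →
          Y-injective i a b j i′ a′ b′ j′ eq (idx-injective {i} {a} {b} {i′} {a′} {b′} (separate _ j _ j′ eq))
      ; extra-≢core = λ i a i′ a′ b′ j′ eq → avoids (idx i′ a′ b′) j′ (subst (_∈ image allCore) eq (core∈ i a))
      ; expansion   = λ i a b lt → subst (λ uv → uncurry IsExpansion uv (Y (idx i a b)))
          (trans (cong endsAt (unidx-idx i a b)) (proj₂ (proj₂ (ends i a b)) lt)) (good (idx i a b))
      }
      where
      Y-injective : ∀ i a b j i′ a′ b′ j′ → Y (idx i a b) j ≡ Y (idx i′ a′ b′) j′ →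
        i ≡ i′ × a ≡ a′ × b ≡ b′ → i ≡ i′ × a ≡ a′ × b ≡ b′ × j ≡ j′
      Y-injective i a b j _ _ _ j′ eq (refl , refl , refl) = refl , refl , refl , proj₁ (good (idx i a b)) j j′ eq

  packing⇒containsKK : ∀ {r} → (∀ e → T (E e) → ∣ e ∣ ≡ r) → ∀ k ℓ → let L = suc (suc ℓ) in
    k * L + k * (L * L) * (r ∸ 2) ≤ B → Packing k L ⊤ → ContainsKK k (suc ℓ) r E
  packing⇒containsKK uni k ℓ le pk = record
    { core            = core
    ; extra           = λ i a b _ → extra i a b
    ; core-inj        = core-inj
    ; extra-inj       = λ i a b _ j i′ a′ b′ _ j′ → extra-inj i a b j i′ a′ b′ j′
    ; core-extra-disj = λ i a i′ a′ b′ _ j′ → extra-≢core i a i′ a′ b′ j′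
    ; edges           = λ i a b lt → proj₂ (expansion i a b lt)
    }
    where
    open Packing pk
    -- There are at least two core indices, so 0 < 1 can serve as the dummy pair.
    open Expansions (expand uni core core-adj zero (suc zero) (s≤s z≤n) le)

-- The extremal construction: freeness and a lower count

∈ᵇ⁻ : (x : Fin n) (S : Subset n) → T (x ∈ᵇ S) → x ∈ S
∈ᵇ⁻ zero    (true ∷ S) _ = here
∈ᵇ⁻ (suc x) (_ ∷ S)    t = there (∈ᵇ⁻ x S t)

∈ᵇ⁺ : {x : Fin n} {S : Subset n} → x ∈ S → T (x ∈ᵇ S)
∈ᵇ⁺ here       = tt
∈ᵇ⁺ (there x∈) = ∈ᵇ⁺ x∈

T-not⁺ : ∀ {a} → ¬ T a → T (not a)
T-not⁺ {true}  ¬t = ¬t tt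
T-not⁺ {false} ¬t = tt

T-not⁻ : ∀ {a} → T (not a) → ¬ T a
T-not⁻ {false} _ ()

module Extremal {n : ℕ} (t ℓ : ℕ) .{{ℓ≢0 : NonZero ℓ}} where

  part : Fin n → ℕ
  part = partOf {n} t ℓ

  -- As in `Sedge`, vertices of `U` are read as lying in part 0, by truncated subtraction. This
  -- affects only sets meeting `U`, whose r-sets are hyperedges in any case.
  Rainbow : Pred (Subset n) 0ℓ
  Rainbow e = ∀ x y → x ∈ e → y ∈ e → part x ≡ part y → x ≡ y

  Sedge⁻ : ∀ r e → T (Sedge {n} t ℓ r e) → ∣ e ∣ ≡ r × ((∃ λ x → x ∈ e × toℕ x < t) ⊎ Rainbow e)
  Sedge⁻ r e h with size , rest ← Equivalence.to (T-∧ {∣ e ∣ ≡ᵇ r}) h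
    with Equivalence.to (T-∨ {List.foldr _∨_ false (map (λ x → (x ∈ᵇ e) ∧ (toℕ x <ᵇ t)) (allFin n))}) rest
  ... | inj₁ meets = ≡ᵇ⇒≡ _ r size , inj₁ (
      let x , h = Any.satisfied (any⁻ (λ x → (x ∈ᵇ e) ∧ (toℕ x <ᵇ t)) (allFin n) meets)
          x∈ , x<t = Equivalence.to (T-∧ {x ∈ᵇ e}) h
      in x , ∈ᵇ⁻ x e x∈ , <ᵇ⇒< _ t x<t)
  ... | inj₂ sep = ≡ᵇ⇒≡ _ r size , inj₂ rainbow
    where
    distinct : ∀ x y → x ∈ e → y ∈ e → toℕ x < toℕ y → part x ≢ part y
    distinct x y x∈ y∈ lt eq = T-not⁻ (T-imp⁻
      (All.lookup (all⁺ _ (allFin n) (All.lookup (all⁺ _ (allFin n) sep) (∈-allFin x))) (∈-allFin y))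
      (Equivalence.from T-∧ (∈ᵇ⁺ x∈ , Equivalence.from T-∧ (∈ᵇ⁺ y∈ , <⇒<ᵇ lt)))) (≡⇒≡ᵇ _ _ eq)
    rainbow : Rainbow e
    rainbow x y x∈ y∈ eq with <-cmp (toℕ x) (toℕ y)
    ... | tri< lt _ _ = contradiction eq (distinct x y x∈ y∈ lt)
    ... | tri≈ _ e _  = Fin.toℕ-injective e
    ... | tri> _ _ gt = contradiction (sym eq) (distinct y x y∈ x∈ gt)

  Sedge⁺ : ∀ r e → ∣ e ∣ ≡ r → Rainbow e → T (Sedge {n} t ℓ r e)
  Sedge⁺ r e size rainbow = Equivalence.from T-∧ (≡⇒≡ᵇ _ r size , Equivalence.from T-∨ (inj₂
    (all⁻ _ (All.universal (λ x → all⁻ _ (All.universal (λ y → T-imp⁺ λ h →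
      let x∈ , h′ = Equivalence.to (T-∧ {x ∈ᵇ e}) h
          y∈ , lt = Equivalence.to (T-∧ {y ∈ᵇ e}) h′
      in T-not⁺ λ eq → <⇒≢ (<ᵇ⇒< _ _ lt) (cong toℕ (rainbow x y (∈ᵇ⁻ x e x∈) (∈ᵇ⁻ y e y∈) (≡ᵇ⇒≡ _ _ eq))))
      (allFin n))) (allFin n)))))

  SGraph : ∀ r → RGraph r n
  SGraph r = record { edge = Sedge {n} t ℓ r ; uniform = λ e h → proj₁ (Sedge⁻ r e h) }

  module Free {k r : ℕ} (t<k : t < k) (c : ContainsKK {n} k ℓ r (Sedge {n} t ℓ r)) where
    open ContainsKK c

    data VertexOf (i : Fin k) : Fin n → Set where
      core-vertex  : ∀ a → VertexOf i (core i a)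
      extra-vertex : ∀ a b p j → VertexOf i (extra i a b p j)

    vertexOf-unique : ∀ {i i′ x y} → VertexOf i x → VertexOf i′ y → x ≡ y → i ≡ i′
    vertexOf-unique (core-vertex a) (core-vertex a′) eq = proj₁ (core-inj _ a _ a′ eq)
    vertexOf-unique (core-vertex a) (extra-vertex a′ b′ p′ j′) eq = contradiction eq (core-extra-disj _ a _ a′ b′ p′ j′)
    vertexOf-unique (extra-vertex a b p j) (core-vertex a′) eq = contradiction (sym eq) (core-extra-disj _ a′ _ a b p j)
    vertexOf-unique (extra-vertex a b p j) (extra-vertex a′ b′ p′ j′) eq = proj₁ (extra-inj _ a b p j _ a′ b′ p′ j′ eq)

    -- Two of the ℓ+1 core vertices of a copy lie in the same part, so the edge through them meets U.
    meets-U : ∀ i → ∃ λ x → VertexOf i x × toℕ x < t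
    meets-U i with Fin.pigeonhole (n<1+n ℓ) (λ a → fromℕ< (m%n<n (toℕ (core i a) ∸ t) ℓ))
    ... | a , b , a<b , eq with proj₂ (Sedge⁻ r _ (edges i a b a<b))
    ...   | inj₂ rainbow = contradiction
              (proj₂ (core-inj i a i b (rainbow _ _ (x∈p∪q⁺ (inj₁ (x∈⁅x⁆ _))) (x∈p∪q⁺ (inj₂ (x∈p∪q⁺ (inj₁ (x∈⁅x⁆ _)))))
                (trans (sym (Fin.toℕ-fromℕ< _)) (trans (cong toℕ eq) (Fin.toℕ-fromℕ< _))))))
              λ { refl → <-irrefl refl a<b }
    ...   | inj₁ (x , x∈ , x<t) with x∈p∪q⁻ ⁅ core i a ⁆ _ x∈
    ...     | inj₁ x∈a rewrite x∈⁅y⁆⇒x≡y _ x∈a = _ , core-vertex a , x<t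
    ...     | inj₂ x∈′ with x∈p∪q⁻ ⁅ core i b ⁆ _ x∈′
    ...       | inj₁ x∈b rewrite x∈⁅y⁆⇒x≡y _ x∈b = _ , core-vertex b , x<t
    ...       | inj₂ x∈X with j , refl ← ∈-image⁻ (extra i a b a<b) x∈X = _ , extra-vertex a b a<b j , x<t

    -- The copies are vertex-disjoint and each has a vertex in `U`, so k of them would need k
    -- different vertices among t < k.
    absurd : ⊥
    absurd with i , i′ , i<i′ , eq ← Fin.pigeonhole t<k (λ i → fromℕ< (proj₂ (proj₂ (meets-U i)))) =
      <-irrefl (cong toℕ (vertexOf-unique (proj₁ (proj₂ (meets-U i))) (proj₁ (proj₂ (meets-U i′)))
        (Fin.toℕ-injective (trans (sym (Fin.toℕ-fromℕ< _)) (trans (cong toℕ eq) (Fin.toℕ-fromℕ< _)))))) i<i′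

  Sedge-free : ∀ {k r} → t < k → ¬ ContainsKK {n} k ℓ r (Sedge {n} t ℓ r)
  Sedge-free t<k c = Free.absurd t<k c

  -- The bound `i` on the parts allows an induction over parts; at `i = ℓ` it is no restriction.
  RainbowBelow : ℕ → ℕ → Pred (Subset n) 0ℓ
  RainbowBelow i s S = ∣ S ∣ ≡ s × (∀ x → x ∈ S → part x < i) × Rainbow S

  rainbowBelow? : ∀ i s → Decidable (RainbowBelow i s)
  rainbowBelow? i s S = ∣ S ∣ ≟ s ×-dec (Fin.all? λ x → x ∈? S →-dec part x <? i) ×-dec
    (Fin.all? λ x → Fin.all? λ y → x ∈? S →-dec y ∈? S →-dec part x ≟ part y →-dec x Fin.≟ y)

  module _ (q : ℕ) (fits : t + ℓ * q ≤ n) where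

    vertex< : ∀ {i} → i < ℓ → (j : Fin q) → t + (i + toℕ j * ℓ) < n
    vertex< {i} i<ℓ j = begin-strict
      t + (i + toℕ j * ℓ)  <⟨ +-monoʳ-< t (+-monoˡ-< (toℕ j * ℓ) i<ℓ) ⟩
      t + suc (toℕ j) * ℓ  ≤⟨ +-monoʳ-≤ t (*-monoˡ-≤ ℓ (Fin.toℕ<n j)) ⟩
      t + q * ℓ            ≡⟨ cong (t +_) (*-comm q ℓ) ⟩
      t + ℓ * q            ≤⟨ fits ⟩
      n                    ∎
      where open ≤-Reasoning

    -- Part i contains t+i, t+i+ℓ, t+i+2ℓ, and so on; `fits` guarantees the first q of these in
    -- every part.
    vertex : ∀ {i} → i < ℓ → Fin q → Fin n
    vertex i<ℓ j = fromℕ< (vertex< i<ℓ j)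

    part-vertex : ∀ {i} (i<ℓ : i < ℓ) j → part (vertex i<ℓ j) ≡ i
    part-vertex {i} i<ℓ j = begin
      (toℕ (vertex i<ℓ j) ∸ t) % ℓ       ≡⟨ cong (λ z → (z ∸ t) % ℓ) (Fin.toℕ-fromℕ< (vertex< i<ℓ j)) ⟩
      (t + (i + toℕ j * ℓ) ∸ t) % ℓ      ≡⟨ cong (_% ℓ) (m+n∸m≡n t _) ⟩
      (i + toℕ j * ℓ) % ℓ                ≡⟨ [m+kn]%n≡m%n i (toℕ j) ℓ ⟩
      i % ℓ                              ≡⟨ m<n⇒m%n≡m i<ℓ ⟩
      i                                  ∎
      where open ≡-Reasoning

    vertex-injective : ∀ {i} (i<ℓ : i < ℓ) j j′ → vertex i<ℓ j ≡ vertex i<ℓ j′ → j ≡ j′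
    vertex-injective {i} i<ℓ j j′ eq = Fin.toℕ-injective (*-cancelʳ-≡ _ _ ℓ (+-cancelˡ-≡ i _ _ (+-cancelˡ-≡ t _ _
      (trans (sym (Fin.toℕ-fromℕ< (vertex< i<ℓ j))) (trans (cong toℕ eq) (Fin.toℕ-fromℕ< (vertex< i<ℓ j′)))))))

    -- Pascal's rule: besides the sets below part i, there are those containing one of the q listed
    -- vertices of part i. A rainbow set contains at most one of these, so the q families are
    -- disjoint, and each receives an injection from the smaller sets below part i.
    #rainbowBelow≥ : ∀ i s → i ≤ ℓ → (i C s) * q ^ s ≤ # (rainbowBelow? i s)
    #rainbowBelow≥ i zero i≤ℓ = #-inhabited (rainbowBelow? i 0)
      (∅ , ∣⊥∣≡0 n , (λ x x∈ → contradiction x∈ ∉⊥) , λ x y x∈ → contradiction x∈ ∉⊥)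
    #rainbowBelow≥ zero (suc s) i≤ℓ = z≤n
    #rainbowBelow≥ (suc i) (suc s) i<ℓ = begin
      (suc i C suc s) * q ^ suc s
        ≡⟨ cong (_* q ^ suc s) (sym (nCk+nC[k+1]≡[n+1]C[k+1] i s)) ⟩
      ((i C s) + (i C suc s)) * q ^ suc s
        ≡⟨ regroup (i C s) (i C suc s) q (q ^ s) ⟩
      (i C suc s) * q ^ suc s + q * ((i C s) * q ^ s)
        ≤⟨ +-mono-≤ (#rainbowBelow≥ i (suc s) (<⇒≤ i<ℓ))
             (#-pack q using? withVertex? (λ j S p → j , p) unique _ many) ⟩
      # (rainbowBelow? i (suc s)) + # using?
        ≤⟨ #-⊎ (rainbowBelow? (suc i) (suc s)) (rainbowBelow? i (suc s)) using?
             (λ S (size , below , rb) → size , (λ x x∈ → m<n⇒m<1+n (below x x∈)) , rb)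
             (λ S (j , _ , rb) → rb)
             (λ S (_ , below , _) (j , x∈ , _) → <-irrefl (part-vertex i<ℓ j) (below _ x∈)) ⟩
      # (rainbowBelow? (suc i) (suc s)) ∎
      where
      open ≤-Reasoning
      regroup : ∀ a b q Q → (a + b) * (q * Q) ≡ b * (q * Q) + q * (a * Q)
      regroup = solve-∀
      WithVertex : Fin q → Pred (Subset n) 0ℓ
      WithVertex j S = vertex i<ℓ j ∈ S × RainbowBelow (suc i) (suc s) S
      withVertex? : ∀ j → Decidable (WithVertex j)
      withVertex? j S = vertex i<ℓ j ∈? S ×-dec rainbowBelow? (suc i) (suc s) S
      using? : Decidable (λ S → ∃ λ j → WithVertex j S)
      using? S = Fin.any? λ j → withVertex? j S
      unique : ∀ j j′ S → WithVertex j S → WithVertex j′ S → j ≡ j′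
      unique j j′ S (x∈ , _ , _ , rb) (y∈ , _) = vertex-injective i<ℓ j j′
        (rb _ _ x∈ y∈ (trans (part-vertex i<ℓ j) (sym (part-vertex i<ℓ j′))))
      many : ∀ j → (i C s) * q ^ s ≤ # (withVertex? j)
      many j = ≤-trans (#rainbowBelow≥ i s (<⇒≤ i<ℓ)) (#-insert x (rainbowBelow? i s) (withVertex? j) add)
        where
        x = vertex i<ℓ j
        add : ∀ S → RainbowBelow i s S → x ∉ S × WithVertex j (S [ x ]≔ inside)
        add S (size , below , rb) = x∉ , []≔-updates S x , trans (∣insert∣ S x x∉) (cong suc size) , below′ , rb′
          where
          x∉ : x ∉ S
          x∉ x∈ = <-irrefl (part-vertex i<ℓ j) (below x x∈)
          below′ : ∀ y → y ∈ S [ x ]≔ inside → part y < suc i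
          below′ y y∈ with insert-∈⁻ S x y∈
          ... | inj₁ refl = s≤s (≤-reflexive (part-vertex i<ℓ j))
          ... | inj₂ y∈S  = m<n⇒m<1+n (below y y∈S)
          rb′ : Rainbow (S [ x ]≔ inside)
          rb′ y z y∈ z∈ eq with insert-∈⁻ S x y∈ | insert-∈⁻ S x z∈
          ... | inj₁ refl | inj₁ refl = refl
          ... | inj₁ refl | inj₂ z∈S  = contradiction (below z z∈S) (<-irrefl (trans (sym eq) (part-vertex i<ℓ j)))
          ... | inj₂ y∈S  | inj₁ refl = contradiction (below y y∈S) (<-irrefl (trans eq (part-vertex i<ℓ j)))
          ... | inj₂ y∈S  | inj₂ z∈S  = rb y z y∈S z∈S eq

    copiesK-Sedge≥ : ∀ s r → (ℓ C s) * q ^ s ≤ copiesK s r (Sedge {n} t ℓ r)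
    copiesK-Sedge≥ s r = ≤-trans (#rainbowBelow≥ ℓ s ≤-refl)
      (#-mono (rainbowBelow? ℓ s) (isCopyK? s r (Sedge {n} t ℓ r)) λ S (size , _ , rb) →
        isCopyK⁺ s r (Sedge {n} t ℓ r) S (size , λ e size-e e⊆S → Sedge⁺ r e size-e
          λ x y x∈ y∈ → rb x y (e⊆S x∈) (e⊆S y∈)))

-- Comparing the two counts asymptotically

0<nCk : ∀ {n k} → k ≤ n → 1 ≤ n C k
0<nCk {n} {zero} _ = ≤-refl
0<nCk {suc n} {suc k} (s≤s k≤n) = ≤-trans (0<nCk k≤n)
  (≤-trans (m≤m+n _ _) (≤-reflexive (nCk+nC[k+1]≡[n+1]C[k+1] n k)))

-- Multiplying the inductive bound by q+c leaves a lowest term cD·q^s, which 1 ≤ q raises to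
-- cD·q^(s+1). The constant `D` is uniform in q.
[q+c]^-bound : ∀ c s → ∃ λ D → ∀ q → 1 ≤ q → (q + c) ^ suc s ≤ q ^ suc s + D * q ^ s
[q+c]^-bound c zero = c , λ q _ → ≤-reflexive (base q c)
  where
  base : ∀ q c → (q + c) * 1 ≡ q * 1 + c * 1
  base = solve-∀
[q+c]^-bound c (suc s) with D , bound ← [q+c]^-bound c s = (c + D + c * D) , λ q 1≤q → begin
  (q + c) * (q + c) ^ suc s
    ≤⟨ *-monoʳ-≤ (q + c) (bound q 1≤q) ⟩
  (q + c) * (q * q ^ s + D * q ^ s)
    ≡⟨ expand q c D (q ^ s) ⟩
  q * (q * q ^ s) + (c + D) * (q * q ^ s) + c * D * (1 * q ^ s)
    ≤⟨ +-monoʳ-≤ _ (*-monoʳ-≤ (c * D) (*-monoˡ-≤ (q ^ s) 1≤q)) ⟩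
  q * (q * q ^ s) + (c + D) * (q * q ^ s) + c * D * (q * q ^ s)
    ≡⟨ collect (q * (q * q ^ s)) (q * q ^ s) c D ⟩
  q * (q * q ^ s) + (c + D + c * D) * (q * q ^ s) ∎
  where
  open ≤-Reasoning
  expand : ∀ q c D Q → (q + c) * (q * Q + D * Q) ≡ q * (q * Q) + (c + D) * (q * Q) + c * D * (1 * Q)
  expand = solve-∀
  collect : ∀ a b c D → a + (c + D) * b + c * D * b ≡ a + (c + D + c * D) * b
  collect = solve-∀

[q+c]^≤[1+c]^*q^ : ∀ c s q → 1 ≤ q → (q + c) ^ s ≤ suc c ^ s * q ^ s
[q+c]^≤[1+c]^*q^ c s q 1≤q = ≤-trans
  (^-monoˡ-≤ s (+-monoʳ-≤ q (≤-trans (≤-reflexive (sym (*-identityʳ c))) (*-monoʳ-≤ c 1≤q))))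
  (≤-reflexive (^-distribʳ-* s (suc c) q))

-- Turns a bound in n into one in the part size q, the variable of the lower count. Inserting the
-- bound on n cancels the normalising power in `zykov`; all else goes into `F`, chosen before n and
-- q.
asymptotic-bound : ∀ ℓ s γ A c → ∃ λ F → ∀ n q K → 1 ≤ q → n ≤ suc ℓ * (q + c) →
  suc ℓ ^ suc s * K ≤ γ * n ^ suc s → K + A * n ^ s ≤ γ * q ^ suc s + F * q ^ s
asymptotic-bound ℓ′ s γ A c with D , bound ← [q+c]^-bound c s = (γ * D + A * (ℓ ^ s * suc c ^ s)) , main
  where
  open ≤-Reasoning
  ℓ = suc ℓ′
  main : ∀ n q K → 1 ≤ q → n ≤ ℓ * (q + c) → ℓ ^ suc s * K ≤ γ * n ^ suc s →
    K + A * n ^ s ≤ γ * q ^ suc s + (γ * D + A * (ℓ ^ s * suc c ^ s)) * q ^ s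
  main n q K 1≤q n≤ K≤ = begin
    K + A * n ^ s
      ≤⟨ +-mono-≤ first (*-monoʳ-≤ A second) ⟩
    γ * (q ^ suc s + D * q ^ s) + A * (ℓ ^ s * (suc c ^ s * q ^ s))
      ≡⟨ collect γ (q ^ suc s) D (q ^ s) A (ℓ ^ s) (suc c ^ s) ⟩
    γ * q ^ suc s + (γ * D + A * (ℓ ^ s * suc c ^ s)) * q ^ s ∎
    where
    collect : ∀ γ Q D R A L M → γ * (Q + D * R) + A * (L * (M * R)) ≡ γ * Q + (γ * D + A * (L * M)) * R
    collect = solve-∀
    second : n ^ s ≤ ℓ ^ s * (suc c ^ s * q ^ s)
    second = begin
      n ^ s                           ≤⟨ ^-monoˡ-≤ s n≤ ⟩
      (ℓ * (q + c)) ^ s               ≡⟨ ^-distribʳ-* s ℓ (q + c) ⟩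
      ℓ ^ s * (q + c) ^ s             ≤⟨ *-monoʳ-≤ (ℓ ^ s) ([q+c]^≤[1+c]^*q^ c s q 1≤q) ⟩
      ℓ ^ s * (suc c ^ s * q ^ s)     ∎
    first : K ≤ γ * (q ^ suc s + D * q ^ s)
    first = *-cancelˡ-≤ (ℓ ^ suc s) {{m^n≢0 ℓ (suc s)}} (begin
      ℓ ^ suc s * K                                 ≤⟨ K≤ ⟩
      γ * n ^ suc s                                 ≤⟨ *-monoʳ-≤ γ (^-monoˡ-≤ (suc s) n≤) ⟩
      γ * (ℓ * (q + c)) ^ suc s                     ≡⟨ cong (γ *_) (^-distribʳ-* (suc s) ℓ (q + c)) ⟩
      γ * (ℓ ^ suc s * (q + c) ^ suc s)             ≤⟨ *-monoʳ-≤ γ (*-monoʳ-≤ (ℓ ^ suc s) (bound q 1≤q)) ⟩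
      γ * (ℓ ^ suc s * (q ^ suc s + D * q ^ s))     ≡⟨ swap γ (ℓ ^ suc s) (q ^ suc s + D * q ^ s) ⟩
      ℓ ^ suc s * (γ * (q ^ suc s + D * q ^ s))     ∎)
      where
      swap : ∀ a b c → a * (b * c) ≡ b * (a * c)
      swap = solve-∀

module UpperBound {n r : ℕ} (G : RGraph r n) (B k ℓ s : ℕ) where
  open LightPairs (edge G) B
  open Cliques Heavy heavy?
  open Packings Heavy heavy? heavy-irrefl
  open ≤-Reasoning

  -- `K` counts the cliques left after the deletions. The error coefficient adds `k * L` for deleted
  -- vertices to `B` for light pairs.
  copiesK-bound : let L = 3 + ℓ in k * L + k * (L * L) * (r ∸ 2) ≤ B →
    2 ≤ r → r ≤ 3 + s → ¬ ContainsKK k (2 + ℓ) r (edge G) →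
    ∃ λ K → (2 + ℓ) ^ (3 + s) * K ≤ ((2 + ℓ) C (3 + s)) * n ^ (3 + s) ×
            copiesK (3 + s) r (edge G) ≤ K + (k * L + B) * n ^ (2 + s)
  copiesK-bound B≥ 2≤r r≤s free =
    conclude (#cliques-unpackable (2 + s) (3 + ℓ) k ⊤ (free ∘ packing⇒containsKK (uniform G) k (suc ℓ) B≥))
    where
    L = 3 + ℓ
    collect : ∀ K k L n N B → K + k * (L * (n * (n * N))) + n * (n * (B * N)) ≡ K + (k * L + B) * (n * (n * N))
    collect = solve-∀
    conclude : (∃ λ W → ¬ HasK L W × #cliques (3 + s) ⊤ ≤ #cliques (3 + s) W + k * (L * n ^ (2 + s))) →
      ∃ λ K → (2 + ℓ) ^ (3 + s) * K ≤ ((2 + ℓ) C (3 + s)) * n ^ (3 + s) ×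
              copiesK (3 + s) r (edge G) ≤ K + (k * L + B) * n ^ (2 + s)
    conclude (W , freeW , le) =
      #cliques (3 + s) W ,
      ≤-trans (zykov (suc ℓ) W freeW (3 + s)) (*-monoʳ-≤ ((2 + ℓ) C (3 + s)) (^-monoˡ-≤ (3 + s) (∣p∣≤n W))) ,
      (begin
        copiesK (3 + s) r (edge G)
          ≤⟨ copiesK≤#cliques r s 2≤r r≤s ⟩
        #cliques (3 + s) ⊤ + n * (n * (B * n ^ s))
          ≤⟨ +-monoˡ-≤ _ le ⟩
        #cliques (3 + s) W + k * (L * n ^ (2 + s)) + n * (n * (B * n ^ s))
          ≡⟨ collect (#cliques (3 + s) W) k L n (n ^ s) B ⟩
        #cliques (3 + s) W + (k * L + B) * n ^ (2 + s) ∎)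

-- `suc t` absorbs two losses: the remainder of the division, which is below the divisor, and the t
-- vertices of `U`.
quotient-bounds : ∀ t ℓ Q n → let q = (n ∸ t) / suc ℓ in t + Q * suc ℓ ≤ n →
  Q ≤ q × t + suc ℓ * q ≤ n × n ≤ suc ℓ * (q + suc t)
quotient-bounds t ℓ′ Q n big = Q≤q , fits , covers
  where
  open ≤-Reasoning
  ℓ = suc ℓ′
  d = (n ∸ t) / ℓ
  t≤n : t ≤ n
  t≤n = m+n≤o⇒m≤o t big
  Q≤q : Q ≤ d
  Q≤q = begin
    Q               ≡⟨ sym (m*n/n≡m Q ℓ) ⟩
    Q * ℓ / ℓ       ≤⟨ /-monoˡ-≤ ℓ (m+n≤o⇒m≤o∸n (Q * ℓ) (≤-trans (≤-reflexive (+-comm (Q * ℓ) t)) big)) ⟩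
    (n ∸ t) / ℓ     ∎
  fits : t + ℓ * d ≤ n
  fits = begin
    t + ℓ * d                       ≡⟨ cong (t +_) (*-comm ℓ d) ⟩
    t + d * ℓ                       ≤⟨ +-monoʳ-≤ t (m≤n+m _ _) ⟩
    t + ((n ∸ t) % ℓ + d * ℓ)       ≡⟨ cong (t +_) (sym (m≡m%n+[m/n]*n (n ∸ t) ℓ)) ⟩
    t + (n ∸ t)                     ≡⟨ m+[n∸m]≡n t≤n ⟩
    n                               ∎
  covers : n ≤ ℓ * (d + suc t)
  covers = begin
    n                               ≡⟨ sym (m+[n∸m]≡n t≤n) ⟩
    t + (n ∸ t)                     ≡⟨ cong (t +_) (m≡m%n+[m/n]*n (n ∸ t) ℓ) ⟩
    t + ((n ∸ t) % ℓ + d * ℓ)       ≤⟨ +-mono-≤ (m≤m+n t (ℓ′ * t)) (+-monoˡ-≤ (d * ℓ) (<⇒≤ (m%n<n (n ∸ t) ℓ))) ⟩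
    ℓ * t + (ℓ + d * ℓ)             ≡⟨ collect ℓ t d ⟩
    ℓ * (d + suc t)                 ∎
    where
    collect : ∀ ℓ t d → ℓ * t + (ℓ + d * ℓ) ≡ ℓ * (d + suc t)
    collect = solve-∀

-- Once q ≥ mF, the term F·q^s is at most 1/m of q^(s+1), and c ≥ 1 lets it be charged to the
-- leading term.
leading-term-dominates : ∀ m c F q s {X Y} → 1 ≤ c → m * F ≤ q →
  X ≤ c * q ^ suc s + F * q ^ s → c * q ^ suc s ≤ Y → m * X ≤ (m + 1) * Y
leading-term-dominates m c F q s {X} {Y} 1≤c mF≤q X≤ ≤Y = begin
  m * X                                     ≤⟨ *-monoʳ-≤ m X≤ ⟩
  m * (c * q ^ suc s + F * q ^ s)           ≡⟨ split m c (q ^ suc s) F (q ^ s) ⟩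
  m * (c * q ^ suc s) + m * F * q ^ s       ≤⟨ +-monoʳ-≤ (m * (c * q ^ suc s)) (*-monoˡ-≤ (q ^ s) mF≤q) ⟩
  m * (c * q ^ suc s) + q ^ suc s           ≡⟨ cong (m * (c * q ^ suc s) +_) (sym (*-identityˡ (q ^ suc s))) ⟩
  m * (c * q ^ suc s) + 1 * q ^ suc s       ≤⟨ +-monoʳ-≤ (m * (c * q ^ suc s)) (*-monoˡ-≤ (q ^ suc s) 1≤c) ⟩
  m * (c * q ^ suc s) + c * q ^ suc s       ≡⟨ factor m (c * q ^ suc s) ⟩
  (m + 1) * (c * q ^ suc s)                 ≤⟨ *-monoʳ-≤ (m + 1) ≤Y ⟩
  (m + 1) * Y                               ∎
  where
  open ≤-Reasoning
  split : ∀ m c Q F R → m * (c * Q + F * R) ≡ m * (c * Q) + m * F * R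
  split = solve-∀
  factor : ∀ m x → m * x + x ≡ (m + 1) * x
  factor = solve-∀

module _ (t ℓ s r m : ℕ) (s≤ℓ : 3 + s ≤ 2 + ℓ) (r≤s : r ≤ 3 + s) (2≤r : 2 ≤ r) where
  private
    k = suc t
    B = k * (3 + ℓ) + k * ((3 + ℓ) * (3 + ℓ)) * (r ∸ 2)
    c = (2 + ℓ) C (3 + s)

  copiesK-asymptotic : ∃ λ N₀ → ∀ n → N₀ ≤ n → (G : RGraph r n) → ¬ ContainsKK k (2 + ℓ) r (edge G) →
    m * copiesK (3 + s) r (edge G) ≤ (m + 1) * copiesK (3 + s) r (Sedge {n} t (2 + ℓ) r)
  copiesK-asymptotic = fromEstimate (asymptotic-bound (suc ℓ) (2 + s) c (k * (3 + ℓ) + B) (suc t))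
    where
    fromEstimate : (∃ λ F → ∀ n q K → 1 ≤ q → n ≤ (2 + ℓ) * (q + suc t) → (2 + ℓ) ^ (3 + s) * K ≤ c * n ^ (3 + s) →
        K + (k * (3 + ℓ) + B) * n ^ (2 + s) ≤ c * q ^ (3 + s) + F * q ^ (2 + s)) →
      ∃ λ N₀ → ∀ n → N₀ ≤ n → (G : RGraph r n) → ¬ ContainsKK k (2 + ℓ) r (edge G) →
        m * copiesK (3 + s) r (edge G) ≤ (m + 1) * copiesK (3 + s) r (Sedge {n} t (2 + ℓ) r)
    -- This threshold forces q ≥ mF+1: mF absorbs the error term, and the extra 1 gives 1 ≤ q.
    fromEstimate (F , estimate) = t + suc (m * F) * (2 + ℓ) , λ n big G free →
      let q = (n ∸ t) / (2 + ℓ)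
          Q≤q , fits , covers = quotient-bounds t (suc ℓ) (suc (m * F)) n big
          K , K≤ , copies≤ = UpperBound.copiesK-bound G B k ℓ s ≤-refl 2≤r r≤s free
      in leading-term-dominates m c F q (2 + s) (0<nCk s≤ℓ) (<⇒≤ Q≤q)
           (≤-trans copies≤ (estimate n q K (≤-trans (s≤s z≤n) Q≤q) covers K≤))
           (Extremal.copiesK-Sedge≥ t (2 + ℓ) q fits (3 + s) r)

theorem2p4 : ∀ (k ℓ s r : ℕ) → 1 ≤ k → s ≤ ℓ → r ≤ s → 3 ≤ r → .{{_ : NonZero ℓ}} →
    ∀ (m : ℕ) → 1 ≤ m → ∃[ N₀ ] ∀ (n : ℕ) → N₀ ≤ n →
    ((∀ (G : RGraph r n) → ¬ ContainsKK k ℓ r (edge G) →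
    m * copiesK s r (edge G) ≤ (m + 1) * copiesK s r (Sedge {n} (k ∸ 1) ℓ r))
    × (∃[ G ] (¬ ContainsKK k ℓ r (edge {r} {n} G)
    × (m ∸ 1) * copiesK s r (Sedge {n} (k ∸ 1) ℓ r) ≤ m * copiesK s r (edge G))))
-- From 3 ≤ r ≤ s ≤ ℓ, matching splits s as 3 + s, for the three vertices prescribed in the
-- light-pair count, and ℓ as 2 + ℓ.
theorem2p4 (suc t) ℓ s r 1≤k s≤ℓ r≤s 3≤r m 1≤m with ≤-trans 3≤r r≤s
theorem2p4 (suc t) (suc (suc ℓ)) (suc (suc (suc s))) r 1≤k s≤ℓ@(s≤s (s≤s _)) r≤s 3≤r m 1≤m | s≤s (s≤s (s≤s z≤n)) =
  proj₁ upper , λ n N₀≤n → proj₂ upper n N₀≤n ,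
    -- The construction is its own witness: `U` has only t = k-1 vertices, and the inequality
    -- reduces to m-1 ≤ m.
    Extremal.SGraph t (2 + ℓ) r , Extremal.Sedge-free t (2 + ℓ) (n<1+n t) , *-monoˡ-≤ _ (m∸n≤m m 1)
  where
  upper = copiesK-asymptotic t ℓ s r m s≤ℓ r≤s (≤-trans (n≤1+n 2) 3≤r)
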